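{- For any NC-path-tree graph $G$ that is not 2-connected (i.e., that contains at least one cut-vertex), the number of leaves in a minimum-leaf spanning tree of $G$ is $\ell$ if and only if the block-cutpoint tree of $G$ has exactly $\ell$ leaves.
   Context: All graphs are finite, simple, loopless, undirected and connected. A path-tree model of $G$ is a pair $(\{P_v\}_{v\in V(G)},T)$ where each $P_v$ is a path (possibly a single node), $T=\bigcup_{v}P_v$ is a tree, and for distinct $u,v$, $uv\in E(G)$ if and only if $P_u$ and $P_v$ share a node. Two paths $P_u,P_v$ are non-crossing if both $P_u\setminus P_v$ and $P_v\setminus P_u$ (obtained by deleting the nodes of the other path) are connected, where the empty set counts as connected. $G$ is an NC-path-tree graph if it has a path-tree model whose paths are pairwise non-crossing. A block of $G$ is a maximal connected subgraph that has no cut-vertex of its own (a maximal 2-connected subgraph, where a single edge counts as 2-connected). The block-cutpoint tree $BC(G)$ has a node for each cut-vertex of $G$ and a node for each block of $G$, and its edge set is $\{cB : c \text{ is a cut-vertex and } B \text{ is a block of } G \text{ containing } c\}$. A minimum-leaf spanning tree of $G$ is a spanning tree of $G$ having the fewest leaves. -}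

module Defs where

open import Data.Bool using (if_then_else_)
open import Data.Empty using (⊥)
open import Data.Fin using (Fin; zero; suc; toℕ; inject₁; fromℕ)
open import Data.Fin.Subset using (Subset; _∈_; _∉_; _⊆_; _∩_; ∁; ⁅_⁆; ∣_∣)
  renaming (⊥ to ∅)
open import Data.Fin.Subset.Properties
  using (_∈?_; ∉⊥; x∈p∩q⁺; x∈p∩q⁻; ⊆-refl; ⊆-trans)
open import Data.Nat using (ℕ; suc; _+_; _≤_; _≟_)
open import Data.Product using (Σ; ∃; ∃!; _×_; _,_; proj₁; proj₂)
open import Data.Sum using (_⊎_; inj₁; inj₂)
open import Data.Sum.Relation.Binary.Pointwise using (_⊎ₛ_)
open import Data.Vec using (tabulate)
open import Function.Bundles using (_⇔_; Inverse)
open import Function.Definitions using (Injective)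
open import Level using (0ℓ)
open import Relation.Binary using (Rel; Setoid; IsEquivalence)
open import Relation.Binary.Construct.Closure.ReflexiveTransitive using (Star)
import Relation.Binary.Construct.On as On
open import Relation.Binary.PropositionalEquality using (_≡_; _≢_; setoid)
open import Relation.Nullary using (¬_; yes; no; does; contradiction)

-- A finite simple graph whose vertices form a subset V of the ambient set
-- Fin n, so that a graph and its subgraphs have the same type.

record Graph (n : ℕ) : Set where
  field
    V       : Subset n
    N       : Fin n → Subset n
    N⊆V     : ∀ {u} → N u ⊆ V
    N-sym   : ∀ {u v} → v ∈ N u → u ∈ N v
    N-irrefl : ∀ {u} → u ∉ N u

  Adj : Rel (Fin n) 0ℓ
  Adj u v = v ∈ N u

open Graph public

private
  variable
    n m : ℕ

infix 4 _⊑_ _≐_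

record _⊑_ (H G : Graph n) : Set where
  field
    V-⊆ : V H ⊆ V G
    N-⊆ : ∀ {u} → N H u ⊆ N G u

open _⊑_ public

_≐_ : Rel (Graph n) 0ℓ
H ≐ G = H ⊑ G × G ⊑ H

⊑-refl : {H : Graph n} → H ⊑ H
⊑-refl = record { V-⊆ = ⊆-refl ; N-⊆ = ⊆-refl }

⊑-trans : {H K L : Graph n} → H ⊑ K → K ⊑ L → H ⊑ L
⊑-trans p q = record
  { V-⊆ = ⊆-trans (V-⊆ p) (V-⊆ q)
  ; N-⊆ = ⊆-trans (N-⊆ p) (N-⊆ q)
  }

≐-isEquivalence : IsEquivalence (_≐_ {n})
≐-isEquivalence = record
  { refl  = ⊑-refl , ⊑-refl
  ; sym   = λ (p , q) → q , p
  ; trans = λ (p , q) (p′ , q′) → ⊑-trans p p′ , ⊑-trans q′ q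
  }

graphSetoid : ℕ → Setoid 0ℓ 0ℓ
graphSetoid n = record { Carrier = Graph n ; isEquivalence = ≐-isEquivalence }

module _ (H : Graph n) (S : Subset n) where

  inducedN : Fin n → Subset n
  inducedN u = if does (u ∈? S) then N H u ∩ S else ∅

  inducedN⁺ : ∀ {u v} → v ∈ N H u → u ∈ S → v ∈ S → v ∈ inducedN u
  inducedN⁺ {u} v∈Nu u∈S v∈S with u ∈? S
  ... | yes _   = x∈p∩q⁺ (v∈Nu , v∈S)
  ... | no  u∉S = contradiction u∈S u∉S

  inducedN⁻ : ∀ {u v} → v ∈ inducedN u → v ∈ N H u × u ∈ S × v ∈ S
  inducedN⁻ {u} v∈ with u ∈? S
  ... | yes u∈S = let v∈Nu , v∈S = x∈p∩q⁻ (N H u) S v∈ in v∈Nu , u∈S , v∈S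
  ... | no  _   = contradiction v∈ ∉⊥

  induced : Graph n
  induced = record
    { V        = V H ∩ S
    ; N        = inducedN
    ; N⊆V      = λ v∈ → let v∈Nu , _ , v∈S = inducedN⁻ v∈ in
                   x∈p∩q⁺ (N⊆V H v∈Nu , v∈S)
    ; N-sym    = λ v∈ → let v∈Nu , u∈S , v∈S = inducedN⁻ v∈ in
                   inducedN⁺ (N-sym H v∈Nu) v∈S u∈S
    ; N-irrefl = λ u∈ → N-irrefl H (proj₁ (inducedN⁻ u∈))
    }

infixl 5 _∖_

_∖_ : Graph n → Subset n → Graph n
H ∖ S = induced H (∁ S)

-- The graph with no vertices counts as connected.

Connected : Graph n → Set
Connected H = ∀ {u v} → u ∈ V H → v ∈ V H → Star (Adj H) u v

record IsPath (H : Graph n) : Set where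
  field
    last      : ℕ
    at        : Fin (suc last) → Fin n
    injective : Injective _≡_ _≡_ at
    vertices  : ∀ {x} → x ∈ V H ⇔ ∃ λ i → at i ≡ x
    edges     : ∀ {i j} → Adj H (at i) (at j) ⇔
                  (toℕ j ≡ suc (toℕ i) ⊎ toℕ i ≡ suc (toℕ j))

record Cycle (H : Graph n) : Set where
  field
    k         : ℕ
    at        : Fin (3 + k) → Fin n
    injective : Injective _≡_ _≡_ at
    step      : ∀ i → Adj H (at (inject₁ i)) (at (suc i))
    close     : Adj H (at (fromℕ (2 + k))) (at zero)

IsTree : Graph n → Set
IsTree H = Connected H × ¬ Cycle H

-- P is used only at the vertices of G; its other values are irrelevant.

record PathTreeModel (G : Graph n) (P : Fin n → Graph m) (T : Graph m) : Set where
  field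
    paths     : ∀ {v} → v ∈ V G → IsPath (P v)
    tree      : IsTree T
    tree-V    : ∀ {x} → x ∈ V T ⇔ ∃ λ v → v ∈ V G × x ∈ V (P v)
    tree-E    : ∀ {x y} → Adj T x y ⇔ ∃ λ v → v ∈ V G × Adj (P v) x y
    intersect : ∀ {u v} → u ∈ V G → v ∈ V G → u ≢ v →
                  Adj G u v ⇔ ∃ λ x → x ∈ V (P u) × x ∈ V (P v)

NonCrossing : Graph m → Graph m → Set
NonCrossing P Q = Connected (P ∖ V Q) × Connected (Q ∖ V P)

NCPathTreeGraph : Graph n → Set
NCPathTreeGraph {n} G =
  Σ ℕ λ m → Σ (Fin n → Graph m) λ P → Σ (Graph m) λ T →
    PathTreeModel G P T ×
    (∀ {u v} → u ∈ V G → v ∈ V G → u ≢ v → NonCrossing (P u) (P v))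

-- Only applied to connected graphs.

CutVertex : Graph n → Fin n → Set
CutVertex H v = v ∈ V H × ¬ Connected (H ∖ ⁅ v ⁆)

TwoConnected : Graph n → Set
TwoConnected H = Connected H × (∀ v → ¬ CutVertex H v)

record Block (G B : Graph n) : Set where
  field
    subgraph     : B ⊑ G
    twoConnected : TwoConnected B
    maximal      : ∀ {C} → C ⊑ G → TwoConnected C → B ⊑ C → C ≐ B

-- The block-cutpoint tree is a graph on a setoid: a cut-vertex or block is
-- determined by its underlying vertex or subgraph, not by the proof that it
-- is one.

module BC (G : Graph n) where

  cutVertices : Setoid 0ℓ 0ℓ
  cutVertices = On.setoid {B = Σ (Fin n) (CutVertex G)} (setoid (Fin n)) proj₁

  blocks : Setoid 0ℓ 0ℓ
  blocks = On.setoid {B = Σ (Graph n) (Block G)} (graphSetoid n) proj₁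

  nodes : Setoid 0ℓ 0ℓ
  nodes = cutVertices ⊎ₛ blocks

  open Setoid nodes using () renaming (Carrier to Node; _≈_ to _≈ᴺ_)

  Edge : Rel Node 0ℓ
  Edge (inj₁ (c , _)) (inj₂ (B , _)) = c ∈ V B
  Edge (inj₂ (B , _)) (inj₁ (c , _)) = c ∈ V B
  Edge (inj₁ _)       (inj₁ _)       = ⊥
  Edge (inj₂ _)       (inj₂ _)       = ⊥

  Leaf : Node → Set
  Leaf x = ∃! _≈ᴺ_ (Edge x)

  leaves : Setoid 0ℓ 0ℓ
  leaves = On.setoid {B = Σ Node Leaf} nodes proj₁

HasExactly : ℕ → Setoid 0ℓ 0ℓ → Set
HasExactly k S = Inverse (setoid (Fin k)) S

leaves : Graph n → Subset n
leaves H = tabulate λ v → does (∣ N H v ∣ ≟ 1)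

record SpanningTree (G T : Graph n) : Set where
  field
    subgraph : T ⊑ G
    spanning : V T ≡ V G
    tree     : IsTree T

MinimumLeafSpanningTree : (G T : Graph n) → Set
MinimumLeafSpanningTree G T =
  SpanningTree G T ×
  (∀ T′ → SpanningTree G T′ → ∣ leaves T ∣ ≤ ∣ leaves T′ ∣)

{-# OPTIONS --safe #-}
module Submission where

-- The intersection graph of subtrees of a tree is chordal, and non-crossing paths exclude claws, so G is
-- a chordal claw-free graph.
--
-- Lower bound: a leaf block B with cut-vertex c is attached to the rest of G only at c, so every spanning
-- tree of G has a leaf in B - c.
--
-- Upper bound: let Z be a set of simplicial vertices meeting every component of G - c for every vertex c.
-- Then G has a spanning tree all of whose leaves lie in Z, by induction on the number of vertices. A
-- simplicial vertex r outside Z is removed; if the tree T obtained for G - r has an edge joining two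
-- neighbours of r, this edge is subdivided by r. Otherwise T joins two neighbours q₁, q₂ of r by a path
-- free of further neighbours of r. Bypassing q₁ and q₂ leaves an edge zz′ with z adjacent to q₁ and z′ to
-- q₂, and zz′ is replaced by z q₁ r q₂ z′. No other vertex loses its degree of at least two.
-- If Z is minimal, then each of its vertices lies in a leaf block of its own.

open import Data.Empty using (⊥; ⊥-elim)
open import Data.Fin using (Fin; zero; suc; toℕ; fromℕ; inject₁; inject≤; _≟_)
open import Data.Fin.Properties using (any?; all?; toℕ-injective; toℕ-inject≤; toℕ-inject₁; toℕ-fromℕ; toℕ<n; injective⇒≤)
  renaming (suc-injective to Fin-suc-injective)
open import Data.Fin.Relation.Unary.Top using (View; view; ‵fromℕ; ‵inject₁)
open import Data.Fin.Subset using (Subset; Nonempty; inside; outside; _∈_; _∉_; _⊆_; _∩_; _∪_; _─_; _-_; ∁; ⁅_⁆; ⊤; ∣_∣)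
open import Data.Fin.Subset.Properties
open import Data.Nat using (ℕ; zero; suc; _+_; _<_; _≤_; z≤n; s≤s)
import Data.Nat as ℕ
open import Data.Nat.Induction using (<-wellFounded; Acc; acc)
open import Data.Nat.Properties using (<-cmp; <-asym; ≤∧≢⇒<; ≤-refl; ≤-trans; ≤-antisym; ≤-total; n≤1+n; 1+n≢n; 1+n≰n; n≮n; +-suc; +-identityʳ; suc-injective)
open import Data.Product using (Σ; ∃; _×_; _,_; proj₁; proj₂)
open import Data.Sum using (_⊎_; inj₁; inj₂; swap; [_,_]′)
import Data.Sum.Relation.Binary.Pointwise as Pointwise
open import Data.Vec using (_∷_; here; there; tabulate)
open import Data.Vec.Functional using (updateAt)
open import Data.Vec.Functional.Properties using (updateAt-updates; updateAt-minimal)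
open import Function using (_∘_; const; Equivalence; Inverse; mk⇔)
open import Function.Bundles using (_⇔_)
open import Function.Definitions using (Injective)
open import Level using (0ℓ)
open import Relation.Binary using (Setoid; tri<; tri≈; tri>)
open import Relation.Binary.Construct.Closure.ReflexiveTransitive using (Star; ε; _◅_; _◅◅_)
import Relation.Binary.Construct.Closure.ReflexiveTransitive as Star
open import Relation.Binary.PropositionalEquality using (_≡_; _≢_; refl; sym; trans; cong; subst)
open import Relation.Nullary using (¬_; Dec; yes; no; does; contradiction)
open import Relation.Nullary.Decidable using (_×-dec_; _⊎-dec_; _→-dec_; ¬?; map′; decidable-stable)
open import Defs

-- Block structure is not inherited when a vertex is deleted, so the induction does not mention it.
-- The condition on `Z` is inherited: a walk can be short-cut past a simplicial vertex, so deleting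
-- an unmarked `r` keeps every component supplied with a mark. Taken at `c` a neighbour of `r`, the
-- condition also provides a second neighbour of `r`. That marks are simplicial keeps them clear of
-- the surgery: if no tree edge joins neighbours of `r`, a marked neighbour would make its tree
-- neighbours adjacent to `r`, so `q₁` and `q₂` are unmarked and have two tree neighbours each.
-- Claw-freeness turns the edges created by bypassing into edges of `G`, and with chordality it
-- yields `zz′`. When every simplicial vertex is marked, a marked one is deleted and later hung back
-- as a leaf; here a mark may have to move. Both bounds are injections between the leaf nodes and
-- the leaves of a tree, and comparing the two gives the exact number.

private
  variable
    m n : ℕ

-- Subsets of a finite set, and subsets given by decidable predicates

x∈p─q⇒x∉q : ∀ (p q : Subset n) {x} → x ∈ p ─ q → x ∉ q
x∈p─q⇒x∉q (_ ∷ p) (inside ∷ q) (there x∈) (there x∈q) = x∈p─q⇒x∉q p q x∈ x∈q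
x∈p─q⇒x∉q (_ ∷ p) (outside ∷ q) (there x∈) (there x∈q) = x∈p─q⇒x∉q p q x∈ x∈q

x∈p-y⇒x≢y : ∀ (p : Subset n) {x y} → x ∈ p - y → x ≢ y
x∈p-y⇒x≢y p {x} x∈ refl = x∈p─q⇒x∉q p ⁅ x ⁆ x∈ (x∈⁅x⁆ x)

p-x⊆p : ∀ (p : Subset n) x → p - x ⊆ p
p-x⊆p p x = p─q⊆p p ⁅ x ⁆

x∈p∪⁅y⁆⁻ : ∀ (p : Subset n) y {x} → x ∈ p ∪ ⁅ y ⁆ → x ∈ p ⊎ x ≡ y
x∈p∪⁅y⁆⁻ p y x∈ with x∈p∪q⁻ p ⁅ y ⁆ x∈
... | inj₁ x∈p = inj₁ x∈p
... | inj₂ x∈y = inj₂ (x∈⁅y⁆⇒x≡y y x∈y)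

p⊆p∪⁅y⁆ : ∀ (p : Subset n) y → p ⊆ p ∪ ⁅ y ⁆
p⊆p∪⁅y⁆ p y = p⊆p∪q ⁅ y ⁆

y∈p∪⁅y⁆ : ∀ (p : Subset n) y → y ∈ p ∪ ⁅ y ⁆
y∈p∪⁅y⁆ p y = q⊆p∪q p ⁅ y ⁆ (x∈⁅x⁆ y)

module _ {P : Fin n → Set} (P? : ∀ x → Dec (P x)) where

  ⟪_⟫ : Subset n
  ⟪_⟫ = tabulate (λ x → does (P? x))

∈-⟪⟫⁺ : ∀ {n} {P : Fin n → Set} (P? : ∀ x → Dec (P x)) {x} → P x → x ∈ ⟪ P? ⟫
∈-⟪⟫⁺ {suc n} P? {zero} px with P? zero
... | yes _ = here
... | no ¬p = contradiction px ¬p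
∈-⟪⟫⁺ {suc n} P? {suc x} px = there (∈-⟪⟫⁺ (λ y → P? (suc y)) px)

∈-⟪⟫⁻ : ∀ {n} {P : Fin n → Set} (P? : ∀ x → Dec (P x)) {x} → x ∈ ⟪ P? ⟫ → P x
∈-⟪⟫⁻ {suc n} P? {zero} x∈ with P? zero
∈-⟪⟫⁻ {suc n} P? {zero} here | yes p = p
∈-⟪⟫⁻ {suc n} P? {suc x} (there x∈) = ∈-⟪⟫⁻ (λ y → P? (suc y)) x∈

-- Walks inside a vertex set

-- With the vertices confined to `S`, deleting a vertex changes the subset and leaves the graph
-- fixed, so inductions on the number of vertices run on `∣ S ∣`.
data Walk (G : Graph n) (S : Subset n) : Fin n → Fin n → Set where
  [_] : ∀ {u} → u ∈ S → Walk G S u u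
  _⟨_⟩_ : ∀ {u v w} → u ∈ S → Adj G u v → Walk G S v w → Walk G S u w

infixr 5 _⟨_⟩_

adj⇒≢ : (G : Graph n) → ∀ {u v} → Adj G u v → u ≢ v
adj⇒≢ G uv refl = N-irrefl G uv

module _ {G : Graph n} where

  head∈ : ∀ {S u v} → Walk G S u v → u ∈ S
  head∈ [ u∈ ] = u∈
  head∈ (u∈ ⟨ _ ⟩ _) = u∈

  last∈ : ∀ {S u v} → Walk G S u v → v ∈ S
  last∈ [ u∈ ] = u∈
  last∈ (_ ⟨ _ ⟩ p) = last∈ p

  mono : ∀ {S S′ u v} → S ⊆ S′ → Walk G S u v → Walk G S′ u v
  mono S⊆ [ u∈ ] = [ S⊆ u∈ ]
  mono S⊆ (u∈ ⟨ a ⟩ p) = S⊆ u∈ ⟨ a ⟩ mono S⊆ p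

  _++_ : ∀ {S u v w} → Walk G S u v → Walk G S v w → Walk G S u w
  [ _ ] ++ q = q
  (u∈ ⟨ a ⟩ p) ++ q = u∈ ⟨ a ⟩ (p ++ q)

  edge : ∀ {S u v} → u ∈ S → v ∈ S → Adj G u v → Walk G S u v
  edge u∈ v∈ a = u∈ ⟨ a ⟩ [ v∈ ]

  reverse : ∀ {S u v} → Walk G S u v → Walk G S v u
  reverse [ u∈ ] = [ u∈ ]
  reverse (u∈ ⟨ a ⟩ p) = reverse p ++ edge (head∈ p) u∈ (N-sym G a)

  -- The cut is at the last visit to `x`: the tail is examined first, so what follows the cut is
  -- free of `x`.
  splitAt : ∀ {S u v} x → Walk G S u v →
            Walk G (S - x) u v ⊎ (x ≡ v ⊎ ∃ λ w → Adj G x w × Walk G (S - x) w v)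
  splitAt {u = u} x [ u∈ ] with u ≟ x
  ... | yes u≡x = inj₂ (inj₁ (sym u≡x))
  ... | no u≢x = inj₁ [ x∈p∧x≢y⇒x∈p-y u∈ u≢x ]
  splitAt {u = u} x (u∈ ⟨ a ⟩ p) with splitAt x p
  ... | inj₂ s = inj₂ s
  ... | inj₁ q with u ≟ x
  ...   | yes refl = inj₂ (inj₂ (_ , a , q))
  ...   | no u≢x = inj₁ (x∈p∧x≢y⇒x∈p-y u∈ u≢x ⟨ a ⟩ q)

  firstStep : ∀ {S u v} → Walk G S u v → u ≡ v ⊎ ∃ λ w → Adj G u w × Walk G (S - u) w v
  firstStep {S} {u} p with splitAt u p
  ... | inj₁ q = contradiction refl (x∈p-y⇒x≢y S (head∈ q))
  ... | inj₂ s = s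

  firstStep≢ : ∀ {S u v} → u ≢ v → Walk G S u v → ∃ λ w → Adj G u w × Walk G (S - u) w v
  firstStep≢ u≢v p with firstStep p
  ... | inj₁ u≡v = contradiction u≡v u≢v
  ... | inj₂ s = s

  stay-in : ∀ {S S′ u v} → (∀ {x y} → x ∈ S′ → y ∈ S → Adj G x y → y ∈ S′) →
           u ∈ S′ → Walk G S u v → Walk G S′ u v
  stay-in cl u∈ [ _ ] = [ u∈ ]
  stay-in cl u∈ (_ ⟨ a ⟩ p) = u∈ ⟨ a ⟩ stay-in cl (cl u∈ (head∈ p) a) p

  -- The walk is stopped at its first arrival at `x`, so all earlier vertices differ from `x`.
  until : ∀ {S R u} x → u ≢ x → Walk G S u x → (∀ {y} → y ∈ S → y ≢ x → y ∈ R) →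
          ∃ λ w → Walk G R u w × Adj G w x
  until x u≢x [ _ ] _ = contradiction refl u≢x
  until x u≢x (_⟨_⟩_ {v = y} u∈ a p) S⊆ with y ≟ x
  ... | yes refl = _ , [ S⊆ u∈ u≢x ] , a
  ... | no y≢x with until x y≢x p S⊆
  ...   | w , q , b = w , (S⊆ u∈ u≢x ⟨ a ⟩ q) , b

  toStar : ∀ {S u v} → Walk G S u v → Star (Adj (induced G S)) u v
  toStar [ _ ] = ε
  toStar {S} (u∈ ⟨ a ⟩ p) = inducedN⁺ G S a u∈ (head∈ p) ◅ toStar p

  fromStar : ∀ {S u v} → u ∈ S → Star (Adj (induced G S)) u v → Walk G S u v
  fromStar u∈ ε = [ u∈ ]
  fromStar {S} u∈ (a ◅ p) =
    let a′ , _ , v∈ = inducedN⁻ G S a in u∈ ⟨ a′ ⟩ fromStar v∈ p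

-- A walk may be assumed to leave its first vertex for good, which shrinks `S` at each step of the
-- search.
walk? : (G : Graph n) → ∀ S u v → Dec (Walk G S u v)
walk? {n} G S u v = go S u (<-wellFounded ∣ S ∣)
  where
  go : ∀ S u → Acc _<_ ∣ S ∣ → Dec (Walk G S u v)
  go S u (acc rec) with u ∈? S
  ... | no u∉ = no (u∉ ∘ head∈)
  ... | yes u∈ with u ≟ v
  ...   | yes refl = yes [ u∈ ]
  ...   | no u≢v =
    map′ (λ (w , a , p) → u∈ ⟨ a ⟩ mono (p-x⊆p S u) p) (firstStep≢ u≢v)
         (any? λ w → (w ∈? N G u) ×-dec go (S - u) w (rec (x∈p⇒∣p-x∣<∣p∣ u∈)))

IsConnected : Graph n → Subset n → Set
IsConnected G S = ∀ {u v} → u ∈ S → v ∈ S → Walk G S u v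

Simplicial : Graph n → Subset n → Fin n → Set
Simplicial G S r = ∀ {a b} → a ∈ S → b ∈ S → Adj G r a → Adj G r b → a ≡ b ⊎ Adj G a b

simplicial? : (G : Graph n) → ∀ S r → Dec (Simplicial G S r)
simplicial? G S r = map′ (λ f {a} {b} → f a b) (λ f a b → f {a} {b})
  (all? λ a → all? λ b → (a ∈? S) →-dec (b ∈? S) →-dec (a ∈? N G r) →-dec (b ∈? N G r) →-dec
    ((a ≟ b) ⊎-dec (b ∈? N G a)))

-- The vertices before and after `r` on the walk are equal or adjacent, so `r` can be cut out.
detour : ∀ {G : Graph n} {S r u v} → Simplicial G S r → u ≢ r → v ≢ r →
         Walk G S u v → Walk G (S - r) u v
detour sim u≢r v≢r [ u∈ ] = [ x∈p∧x≢y⇒x∈p-y u∈ u≢r ]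
detour {G = G} {S} {r} {u} {v} sim u≢r v≢r (_⟨_⟩_ {v = y} u∈ a p) with y ≟ r
... | no y≢r = x∈p∧x≢y⇒x∈p-y u∈ u≢r ⟨ a ⟩ detour sim y≢r v≢r p
detour {G = G} {S} {r} {u} {v} sim u≢r v≢r (u∈ ⟨ a ⟩ [ _ ]) | yes refl = contradiction refl v≢r
detour {G = G} {S} {r} {u} {v} sim u≢r v≢r (u∈ ⟨ a ⟩ _⟨_⟩_ {v = z} _ b p) | yes refl
  with detour {G = G} {S} {r} sim (λ { refl → N-irrefl G b }) v≢r p | sim u∈ (head∈ p) (N-sym G a) b
... | q | inj₁ refl = q
... | q | inj₂ c = x∈p∧x≢y⇒x∈p-y u∈ u≢r ⟨ c ⟩ q

-- Chordal and claw-free graphs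

-- Chordality in its perfect-elimination form, with simpliciality meant in the subgraph induced by
-- `S`. This is what pruning a host tree yields and what the inductions consume.
Chordal : Graph n → Set
Chordal G = ∀ S → Nonempty S → ∃ λ r → r ∈ S × Simplicial G S r

ClawFree : Graph n → Set
ClawFree G = ∀ {x a b c} → Adj G x a → Adj G x b → Adj G x c →
             a ≢ b → a ≢ c → b ≢ c → Adj G a b ⊎ Adj G a c ⊎ Adj G b c

Clique : Graph n → Subset n → Set
Clique G C = ∀ {a b} → a ∈ C → b ∈ C → a ≡ b ⊎ Adj G a b

module _ {G : Graph n} where

  simplicial-mono : ∀ {S S′ r} → S ⊆ S′ → Simplicial G S′ r → Simplicial G S r
  simplicial-mono S⊆ sim a∈ b∈ = sim (S⊆ a∈) (S⊆ b∈)

  simplicial-add : ∀ {S r s} → ¬ Adj G r s → Simplicial G (S - r) s → Simplicial G S s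
  simplicial-add {S} {r} {s} ¬rs sim {a} {b} a∈ b∈ sa sb =
    sim (x∈p∧x≢y⇒x∈p-y a∈ (λ { refl → ¬rs (N-sym G sa) }))
        (x∈p∧x≢y⇒x∈p-y b∈ (λ { refl → ¬rs (N-sym G sb) })) sa sb

  simplicial-dominated : ∀ {S r s} → (∀ {a} → a ∈ S → Adj G s a → a ≡ r ⊎ Adj G r a) →
                         Simplicial G S r → Simplicial G S s
  simplicial-dominated close sim a∈ b∈ sa sb with close a∈ sa | close b∈ sb
  ... | inj₁ refl | inj₁ refl = inj₁ refl
  ... | inj₁ refl | inj₂ rb = inj₂ rb
  ... | inj₂ ra | inj₁ refl = inj₂ (N-sym G ra)
  ... | inj₂ ra | inj₂ rb = sim a∈ b∈ ra rb

  -- A sharpened form of Dirac's theorem on two simplicial vertices: every component left by a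
  -- clique `C` contains a vertex simplicial in all of `S`. Delete a simplicial `r` and induct. If
  -- `r` is outside `C`, the vertex found either is not adjacent to `r` and stays simplicial, or
  -- leads to `r` itself.
  simplicial-end : Chordal G → ∀ {S C u} → Clique G C → u ∈ S → u ∉ C →
                   ∃ λ s → s ∉ C × Simplicial G S s × Walk G (S ─ C) u s
  simplicial-end chordal {S} {C} {u} = go S C u (<-wellFounded ∣ S ∣)
    where
    go : ∀ S C u → Acc _<_ ∣ S ∣ → Clique G C → u ∈ S → u ∉ C →
         ∃ λ s → s ∉ C × Simplicial G S s × Walk G (S ─ C) u s
    go S C u (acc rec) clique u∈ u∉ with chordal S (u , u∈)
    ... | r , r∈ , sim with r ∈? C
    ...   | no r∉ with u ≟ r
    ...     | yes refl = r , r∉ , sim , [ x∈p∧x∉q⇒x∈p─q r∈ r∉ ]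
    ...     | no u≢r with go (S - r) C u (rec (x∈p⇒∣p-x∣<∣p∣ r∈)) clique (x∈p∧x≢y⇒x∈p-y u∈ u≢r) u∉
    ...       | s , s∉ , sim-s , p with s ∈? N G r
    ...         | no ¬rs = s , s∉ , simplicial-add ¬rs sim-s , mono sub p
      where
      sub : (S - r) ─ C ⊆ S ─ C
      sub x∈ = x∈p∧x∉q⇒x∈p─q (p-x⊆p S r (p─q⊆p (S - r) C x∈)) (x∈p─q⇒x∉q (S - r) C x∈)
    ...         | yes rs = r , r∉ , sim ,
                   (mono sub p ++ edge (last∈ (mono sub p)) (x∈p∧x∉q⇒x∈p─q r∈ r∉) (N-sym G rs))
      where
      sub : (S - r) ─ C ⊆ S ─ C
      sub x∈ = x∈p∧x∉q⇒x∈p─q (p-x⊆p S r (p─q⊆p (S - r) C x∈)) (x∈p─q⇒x∉q (S - r) C x∈)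
    go S C u (acc rec) clique u∈ u∉ | r , r∈ , sim | yes r∈C = result
      where
      -- As `r` lies in the clique `C`, all of `C` lies in the closed neighbourhood of `r`, so the
      -- clique `Q` can replace `C`. A vertex found outside `Q` is not adjacent to `r` and remains
      -- simplicial when `r` returns.
      Q : Subset _
      Q = N G r ∩ S
      Q⁻ : ∀ {x} → x ∈ Q → Adj G r x × x ∈ S
      Q⁻ = x∈p∩q⁻ (N G r) S
      Q-clique : Clique G Q
      Q-clique a∈ b∈ = let ra , a∈S = Q⁻ a∈ ; rb , b∈S = Q⁻ b∈ in sim a∈S b∈S ra rb
      sub : (S - r) ─ Q ⊆ S ─ C
      sub {x} x∈ = x∈p∧x∉q⇒x∈p─q x∈S x∉C
        where
        x∈S-r = p─q⊆p (S - r) Q x∈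
        x∈S = p-x⊆p S r x∈S-r
        x∉C : x ∉ C
        x∉C x∈C with clique r∈C x∈C
        ... | inj₁ r≡x = x∈p-y⇒x≢y S x∈S-r (sym r≡x)
        ... | inj₂ rx = x∈p─q⇒x∉q (S - r) Q x∈ (x∈p∩q⁺ (rx , x∈S))
      far : ∀ {v} → v ∈ S → v ≢ r → ¬ Adj G r v →
            ∃ λ s → s ∉ C × Simplicial G S s × Walk G (S ─ C) v s
      far {v} v∈ v≢r ¬rv
        with go (S - r) Q v (rec (x∈p⇒∣p-x∣<∣p∣ r∈)) Q-clique (x∈p∧x≢y⇒x∈p-y v∈ v≢r) (¬rv ∘ proj₁ ∘ Q⁻)
      ... | s , s∉Q , sim-s , p =
        s , x∈p─q⇒x∉q S C s∈ , simplicial-add (λ rs → s∉Q (x∈p∩q⁺ (rs , p─q⊆p S C s∈))) sim-s , q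
        where
        q = mono sub p
        s∈ = last∈ q
      result : ∃ λ s → s ∉ C × Simplicial G S s × Walk G (S ─ C) u s
      result with u ∈? N G r
      ... | no ¬ru = far u∈ (λ { refl → u∉ r∈C }) ¬ru
      ... | yes ru with any? (λ v → (v ∈? S) ×-dec (v ∈? N G u) ×-dec ¬? (v ≟ r) ×-dec ¬? (v ∈? N G r))
      ...   | yes (v , v∈ , uv , v≢r , ¬rv) =
              let s , s∉ , sim-s , p = far v∈ v≢r ¬rv in
              s , s∉ , sim-s , x∈p∧x∉q⇒x∈p─q u∈ u∉ ⟨ uv ⟩ p
      ...   | no none = u , u∉ , sim-u , [ x∈p∧x∉q⇒x∈p─q u∈ u∉ ]
        where
        close : ∀ {a} → a ∈ S → Adj G u a → a ≡ r ⊎ Adj G r a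
        close {a} a∈ ua with a ≟ r | a ∈? N G r
        ... | yes a≡r | _ = inj₁ a≡r
        ... | no _ | yes ra = inj₂ ra
        ... | no a≢r | no ¬ra = contradiction (a , a∈ , ua , a≢r , ¬ra) none
        sim-u : Simplicial G S u
        sim-u = simplicial-dominated close sim

  -- Take a simplicial vertex of `Y` with `w` added. If it is `w`, then `u` and `v` are adjacent; if
  -- it is an end of the walk, the next vertex of the walk is adjacent to `w` and takes its place;
  -- any other vertex can be short-cut past and deleted.
  neighbourhood-walk : Chordal G → ∀ {Y w u v} → w ∉ Y → Adj G w u → Adj G w v →
                       Walk G Y u v → Walk G (Y ∩ N G w) u v
  neighbourhood-walk chordal {Y} {w} {u} {v} = go Y u v (<-wellFounded ∣ Y ∣)
    where
    go : ∀ Y u v → Acc _<_ ∣ Y ∣ → w ∉ Y → Adj G w u → Adj G w v →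
         Walk G Y u v → Walk G (Y ∩ N G w) u v
    from-end : ∀ Y u v → Acc _<_ ∣ Y ∣ → w ∉ Y →
               Adj G w u → Adj G w v → u ≢ v → Simplicial G (Y ∪ ⁅ w ⁆) u →
               Walk G Y u v → Walk G (Y ∩ N G w) u v
    go Y u v a w∉ wu wv p with u ≟ v
    ... | yes refl = [ x∈p∩q⁺ (head∈ p , wu) ]
    ... | no u≢v with chordal (Y ∪ ⁅ w ⁆) (w , y∈p∪⁅y⁆ Y w)
    ...   | r , r∈ , sim with r ≟ u | r ≟ v | x∈p∪⁅y⁆⁻ Y w r∈
    ...     | yes refl | _ | _ = from-end Y u v a w∉ wu wv u≢v sim p
    ...     | no _ | yes refl | _ =
              reverse (from-end Y v u a w∉ wv wu (u≢v ∘ sym) sim (reverse p))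
    ...     | no _ | no _ | inj₂ refl
              with sim (p⊆p∪⁅y⁆ Y w (head∈ p)) (p⊆p∪⁅y⁆ Y w (last∈ p)) wu wv
    ...       | inj₁ u≡v = contradiction u≡v u≢v
    ...       | inj₂ uv = edge (x∈p∩q⁺ (head∈ p , wu)) (x∈p∩q⁺ (last∈ p , wv)) uv
    go Y u v (acc rec) w∉ wu wv p | no _ | r , r∈ , sim | no r≢u | no r≢v | inj₁ r∈Y =
      mono (λ x∈ → let x∈Y , x∈N = x∈p∩q⁻ (Y - r) (N G w) x∈ in x∈p∩q⁺ (p-x⊆p Y r x∈Y , x∈N))
        (go (Y - r) u v (rec (x∈p⇒∣p-x∣<∣p∣ r∈Y)) (w∉ ∘ p-x⊆p Y r) wu wv
          (detour (simplicial-mono (p⊆p∪⁅y⁆ Y w) sim) (r≢u ∘ sym) (r≢v ∘ sym) p))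
    from-end Y u v (acc rec) w∉ wu wv u≢v sim p with firstStep≢ u≢v p
    ... | x , ux , q
      with sim (p⊆p∪⁅y⁆ Y w (p-x⊆p Y u (head∈ q))) (y∈p∪⁅y⁆ Y w) ux (N-sym G wu)
    ...   | inj₁ refl = contradiction (p-x⊆p Y u (head∈ q)) w∉
    ...   | inj₂ xw = x∈p∩q⁺ (head∈ p , wu) ⟨ ux ⟩
              mono (λ x∈ → let x∈Y , x∈N = x∈p∩q⁻ (Y - u) (N G w) x∈ in x∈p∩q⁺ (p-x⊆p Y u x∈Y , x∈N))
                (go (Y - u) x v (rec (x∈p⇒∣p-x∣<∣p∣ (head∈ p))) (w∉ ∘ p-x⊆p Y u) (N-sym G xw) wv q)

  -- The edge `q₁q₂` lies on a closed walk through `Y`, so it lies in a triangle with apex in `Y`: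
  -- inside the neighbourhood of `q₁`, walk from `u` to `q₂` and look at the vertex next to `q₂`.
  common-neighbour : Chordal G → ∀ {Y q₁ q₂ u v} → q₁ ∉ Y → q₂ ∉ Y → Adj G q₁ q₂ →
                     Adj G q₁ u → Adj G q₂ v → Walk G Y u v →
                     ∃ λ z → z ∈ Y × Adj G q₁ z × Adj G q₂ z
  common-neighbour chordal {Y} {q₁} {q₂} {u} {v} q₁∉ q₂∉ q₁q₂ q₁u q₂v p
    with firstStep≢ (λ { refl → q₂∉ (head∈ p) }) (reverse
           (neighbourhood-walk chordal q₁∉′ q₁u q₁q₂
             (mono (p⊆p∪⁅y⁆ Y q₂) p ++
              edge (p⊆p∪⁅y⁆ Y q₂ (last∈ p)) (y∈p∪⁅y⁆ Y q₂) (N-sym G q₂v))))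
    where
    q₁∉′ : q₁ ∉ Y ∪ ⁅ q₂ ⁆
    q₁∉′ q₁∈ with x∈p∪⁅y⁆⁻ Y q₂ q₁∈
    ... | inj₁ q₁∈Y = q₁∉ q₁∈Y
    ... | inj₂ refl = N-irrefl G q₁q₂
  ... | z , q₂z , q with x∈p∩q⁻ (Y ∪ ⁅ q₂ ⁆) (N G q₁) (p-x⊆p ((Y ∪ ⁅ q₂ ⁆) ∩ N G q₁) q₂ (head∈ q))
  ...   | z∈ , q₁z with x∈p∪⁅y⁆⁻ Y q₂ z∈
  ...     | inj₁ z∈Y = z , z∈Y , q₁z , q₂z
  ...     | inj₂ refl = contradiction q₂z (N-irrefl G)

-- Rooted trees as parent pointers

-- The condition `x ≢ ρ` in `up` ends the climb at the first arrival at `ρ`, so its length depends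
-- on `x` alone and can serve as depth.
data Reach {n} (ρ : Fin n) (π : Fin n → Fin n) : Fin n → Set where
  here : Reach ρ π ρ
  up   : ∀ {x} → x ≢ ρ → Reach ρ π (π x) → Reach ρ π x

module _ {ρ : Fin n} {π : Fin n → Fin n} where

  len : ∀ {x} → Reach ρ π x → ℕ
  len here = 0
  len (up _ p) = suc (len p)

  len-unique : ∀ {x} (p q : Reach ρ π x) → len p ≡ len q
  len-unique here here = refl
  len-unique here (up x≢ _) = contradiction refl x≢
  len-unique (up x≢ _) here = contradiction refl x≢
  len-unique (up _ p) (up _ q) = cong suc (len-unique p q)

-- Pointers allow surgery by local redefinition, and `reach` takes the place of acyclicity. The
-- vertex set is a predicate so that it can grow by `⊎` and shrink by `×`.
record Tree {n} (S : Fin n → Set) : Set where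
  field
    root    : Fin n
    root∈   : S root
    parent  : Fin n → Fin n
    parent∈ : ∀ {x} → S x → x ≢ root → S (parent x)
    reach   : ∀ {x} → S x → Reach root parent x

  Child : Fin n → Fin n → Set
  Child x y = S x × x ≢ root × parent x ≡ y

  E : Fin n → Fin n → Set
  E x y = Child x y ⊎ Child y x

  E-sym : ∀ {x y} → E x y → E y x
  E-sym = swap

  E-S : ∀ {x y} → E x y → S x
  E-S (inj₁ (x∈ , _)) = x∈
  E-S (inj₂ (y∈ , y≢ , refl)) = parent∈ y∈ y≢

  depth : ∀ {x} → S x → ℕ
  depth x∈ = len (reach x∈)

  child-depth : ∀ {x y} → Child x y → (x∈ : S x) (y∈ : S y) → depth x∈ ≡ suc (depth y∈)
  child-depth (_ , x≢ , refl) x∈ y∈ = len-unique (reach x∈) (up x≢ (reach y∈))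

  E-irrefl : ∀ {x} → ¬ E x x
  E-irrefl (inj₁ c) = 1+n≢n (sym (child-depth c (proj₁ c) (proj₁ c)))
  E-irrefl (inj₂ c) = 1+n≢n (sym (child-depth c (proj₁ c) (proj₁ c)))

  E-depth : ∀ {x y} → E x y → (x∈ : S x) (y∈ : S y) →
            depth x∈ ≡ suc (depth y∈) ⊎ depth y∈ ≡ suc (depth x∈)
  E-depth (inj₁ c) x∈ y∈ = inj₁ (child-depth c x∈ y∈)
  E-depth (inj₂ c) x∈ y∈ = inj₂ (child-depth c y∈ x∈)

  -- Depths of adjacent vertices differ by one, so closed walks have even length. This guarantees
  -- that a neighbour gained by bypassing differs from the old ones.
  E-triangle-free : ∀ {x y z} → E x y → E y z → ¬ E x z
  E-triangle-free xy yz xz =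
    parity (E-depth xy (E-S xy) (E-S yz)) (E-depth yz (E-S yz) (E-S (E-sym xz)))
           (E-depth xz (E-S xy) (E-S (E-sym xz)))
    where
    parity : ∀ {a b c} → a ≡ suc b ⊎ b ≡ suc a → b ≡ suc c ⊎ c ≡ suc b → ¬ (a ≡ suc c ⊎ c ≡ suc a)
    parity (inj₁ refl) (inj₁ refl) (inj₁ ())
    parity (inj₁ refl) (inj₁ refl) (inj₂ ())
    parity (inj₁ refl) (inj₂ refl) (inj₁ ())
    parity (inj₁ refl) (inj₂ refl) (inj₂ ())
    parity (inj₂ refl) (inj₁ refl) (inj₁ ())
    parity (inj₂ refl) (inj₁ refl) (inj₂ ())
    parity (inj₂ refl) (inj₂ refl) (inj₁ ())
    parity (inj₂ refl) (inj₂ refl) (inj₂ ())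

  to-root : ∀ {x} → S x → Star E x root
  to-root x∈ = go x∈ (reach x∈)
    where
    go : ∀ {x} → S x → Reach root parent x → Star E x root
    go x∈ here = ε
    go x∈ (up x≢ p) = inj₁ (x∈ , x≢ , refl) ◅ go (parent∈ x∈ x≢) p

  connected : ∀ {x y} → S x → S y → Star E x y
  connected x∈ y∈ = to-root x∈ ◅◅ Star.reverse E-sym (to-root y∈)

  -- Degree at least two, that is, not a leaf and not the only vertex.
  Branching : Fin n → Set
  Branching x = ∃ λ y → ∃ λ z → y ≢ z × E x y × E x z

  root-child : ∀ {x} → E root x → Child x root
  root-child (inj₁ (_ , ρ≢ρ , _)) = contradiction refl ρ≢ρ
  root-child (inj₂ c) = c

open Tree using (E; Branching) public

single : (x : Fin n) → Tree (_≡ x)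
single x = record
  { root = x ; root∈ = refl ; parent = λ y → y
  ; parent∈ = λ x≡ _ → x≡ ; reach = λ { refl → here } }

_⇔ᴱ_ : ∀ {S : Fin n → Set} → Tree S → Tree S → Set
T ⇔ᴱ T′ = (∀ {x y} → E T x y → E T′ x y) × (∀ {x y} → E T′ x y → E T x y)

module _ {S : Fin n → Set} where

  reroot-child : (T : Tree S) → ∀ {c} → Tree.Child T c (Tree.root T) →
                 Σ (Tree S) λ T′ → Tree.root T′ ≡ c × T ⇔ᴱ T′
  reroot-child T {c} (c∈ , c≢ρ , πc≡ρ) = T′ , refl , E⇒E′ , E′⇒E
    where
    open Tree T renaming (root to ρ; parent to π; E to E₀) hiding (Branching)
    π′ : Fin _ → Fin _
    π′ = updateAt π ρ (const c)
    π′ρ : π′ ρ ≡ c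
    π′ρ = updateAt-updates ρ π
    π′≢ : ∀ {x} → x ≢ ρ → π′ x ≡ π x
    π′≢ {x} x≢ρ = updateAt-minimal x ρ π x≢ρ
    reach′ : ∀ {x} → Reach ρ π x → Reach c π′ x
    reach′ here = up (c≢ρ ∘ sym) (subst (Reach c π′) (sym π′ρ) here)
    reach′ {x} (up x≢ρ p) with x ≟ c
    ... | yes refl = here
    ... | no x≢c = up x≢c (subst (Reach c π′) (sym (π′≢ x≢ρ)) (reach′ p))
    parent∈′ : ∀ {x} → S x → x ≢ c → S (π′ x)
    parent∈′ {x} x∈ x≢c with x ≟ ρ
    ... | yes refl = subst S (sym π′ρ) c∈
    ... | no x≢ρ = subst S (sym (π′≢ x≢ρ)) (parent∈ x∈ x≢ρ)
    T′ : Tree S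
    T′ = record { root = c ; root∈ = c∈ ; parent = π′ ; parent∈ = parent∈′
                ; reach = λ x∈ → reach′ (reach x∈) }
    child⇒ : ∀ {x y} → Child x y → E T′ x y
    child⇒ {x} (x∈ , x≢ρ , refl) with x ≟ c
    ... | yes refl = inj₂ (subst S (sym πc≡ρ) root∈ , (λ πc≡c → c≢ρ (trans (sym πc≡c) πc≡ρ)) ,
                           trans (cong π′ πc≡ρ) π′ρ)
    ... | no x≢c = inj₁ (x∈ , x≢c , π′≢ x≢ρ)
    child⇐ : ∀ {x y} → Tree.Child T′ x y → E₀ x y
    child⇐ {x} (x∈ , x≢c , refl) with x ≟ ρ
    ... | yes refl = inj₂ (subst Sc (sym π′ρ) (c∈ , c≢ρ , πc≡ρ))
      where Sc : Fin _ → Set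
            Sc y = Child y ρ
    ... | no x≢ρ = inj₁ (x∈ , x≢ρ , sym (π′≢ x≢ρ))
    E⇒E′ : ∀ {x y} → E₀ x y → E T′ x y
    E⇒E′ (inj₁ c) = child⇒ c
    E⇒E′ (inj₂ c) = swap (child⇒ c)
    E′⇒E : ∀ {x y} → E T′ x y → E₀ x y
    E′⇒E (inj₁ c) = child⇐ c
    E′⇒E (inj₂ c) = swap (child⇐ c)

  -- The pointers on the path from the root to `a` are reversed one at a time. Moving the root to
  -- the place of surgery makes the edge concerned one between the root and a child.
  reroot : (T : Tree S) → ∀ {a} → S a → Σ (Tree S) λ T′ → Tree.root T′ ≡ a × T ⇔ᴱ T′
  reroot T a∈ = go T ((λ e → e) , (λ e → e)) refl (Tree.connected T (Tree.root∈ T) a∈)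
    where
    go : ∀ T′ {x a} → T ⇔ᴱ T′ → Tree.root T′ ≡ x → Star (E T) x a →
         Σ (Tree S) λ T″ → Tree.root T″ ≡ a × T ⇔ᴱ T″
    go T′ iso eq ε = T′ , eq , iso
    go T′ (to , from) refl (e ◅ es) =
      let T″ , eq , to′ , from′ = reroot-child T′ (Tree.root-child T′ (to e))
      in go T″ ((λ e → to′ (to e)) , (λ e → from (from′ e))) eq es

  transport : ∀ {S′ : Fin n → Set} → (∀ {x} → S x → S′ x) → (∀ {x} → S′ x → S x) → (T : Tree S) →
              Σ (Tree S′) λ T′ → (∀ {x y} → E T x y → E T′ x y) × (∀ {x y} → E T′ x y → E T x y)
  transport f g T = record
      { root = root ; root∈ = f root∈ ; parent = parent
      ; parent∈ = λ x∈ x≢ → f (parent∈ (g x∈) x≢) ; reach = λ x∈ → reach (g x∈) }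
    , (λ { (inj₁ (x∈ , r)) → inj₁ (f x∈ , r) ; (inj₂ (x∈ , r)) → inj₂ (f x∈ , r) })
    , (λ { (inj₁ (x∈ , r)) → inj₁ (g x∈ , r) ; (inj₂ (x∈ , r)) → inj₂ (g x∈ , r) })
    where open Tree T

-- Surgery on trees: attaching, subdividing and bypassing

SamePair : (a b u v : Fin n) → Set
SamePair a b u v = (u ≡ a × v ≡ b) ⊎ (u ≡ b × v ≡ a)

samePair-swap : ∀ {a b u v : Fin n} → SamePair a b u v → SamePair a b v u
samePair-swap (inj₁ (p , q)) = inj₂ (q , p)
samePair-swap (inj₂ (p , q)) = inj₁ (q , p)

module _ {S : Fin n → Set} (T : Tree S) {r : Fin n} (r∉ : ¬ S r) where

  private
    S⁺ : Fin n → Set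
    S⁺ x = S x ⊎ x ≡ r

  attach : ∀ {p} → S p → Σ (Tree S⁺) λ T′ →
           (∀ {x y} → E T x y → E T′ x y) × E T′ r p ×
           (∀ {x y} → E T′ x y → E T x y ⊎ SamePair r p x y)
  attach {p} p∈ = T′ , keep , inj₁ (inj₂ refl , r≢ρ , π′r) , back
    where
    open Tree T renaming (root to ρ; parent to π; E to E₀) hiding (Branching)
    π′ : Fin n → Fin n
    π′ = updateAt π r (const p)
    π′r : π′ r ≡ p
    π′r = updateAt-updates r π
    S⇒≢r : ∀ {x} → S x → x ≢ r
    S⇒≢r x∈ refl = r∉ x∈
    π′≡ : ∀ {x} → S x → π′ x ≡ π x
    π′≡ {x} x∈ = updateAt-minimal x r π (S⇒≢r x∈)
    r≢ρ : r ≢ ρ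
    r≢ρ refl = r∉ root∈
    reach-old : ∀ {x} → S x → Reach ρ π x → Reach ρ π′ x
    reach-old x∈ here = here
    reach-old x∈ (up x≢ q) =
      up x≢ (subst (Reach ρ π′) (sym (π′≡ x∈)) (reach-old (parent∈ x∈ x≢) q))
    T′ : Tree S⁺
    T′ = record
      { root = ρ ; root∈ = inj₁ root∈ ; parent = π′
      ; parent∈ = λ { (inj₁ x∈) x≢ → inj₁ (subst S (sym (π′≡ x∈)) (parent∈ x∈ x≢))
                    ; (inj₂ refl) _ → inj₁ (subst S (sym π′r) p∈) }
      ; reach = λ { (inj₁ x∈) → reach-old x∈ (reach x∈)
                  ; (inj₂ refl) → up r≢ρ (subst (Reach ρ π′) (sym π′r) (reach-old p∈ (reach p∈))) } }
    keep-child : ∀ {x y} → Child x y → Tree.Child T′ x y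
    keep-child (x∈ , x≢ , refl) = inj₁ x∈ , x≢ , π′≡ x∈
    keep : ∀ {x y} → E₀ x y → E T′ x y
    keep (inj₁ c) = inj₁ (keep-child c)
    keep (inj₂ c) = inj₂ (keep-child c)
    back-child : ∀ {x y} → Tree.Child T′ x y → E₀ x y ⊎ SamePair r p x y
    back-child (inj₁ x∈ , x≢ , refl) = inj₁ (inj₁ (x∈ , x≢ , sym (π′≡ x∈)))
    back-child (inj₂ refl , _ , refl) = inj₂ (inj₁ (refl , π′r))
    back : ∀ {x y} → E T′ x y → E₀ x y ⊎ SamePair r p x y
    back (inj₁ c) = back-child c
    back (inj₂ c) with back-child c
    ... | inj₁ e = inj₁ (swap e)
    ... | inj₂ s = inj₂ (samePair-swap s)

  -- Rooted at `a`, the tree has `b` as a child of the root, so only two pointers change: `b` now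
  -- points to `r`, and `r` to the root.
  subdivide : ∀ {a b} → E T a b → Σ (Tree S⁺) λ T′ →
              (∀ {x y} → E T x y → ¬ SamePair a b x y → E T′ x y) × E T′ r a × E T′ b r ×
              (∀ {x y} → E T′ x y → (E T x y × ¬ SamePair a b x y) ⊎ SamePair r a x y ⊎ SamePair r b x y)
  subdivide {a} {b} ab with reroot T (Tree.E-S T ab)
  ... | T₁ , refl , to , from = T′ , keep , inj₁ (inj₂ refl , r≢ρ , π′r) , inj₁ (inj₁ b∈ , b≢ρ , π′b) , back
    where
    open Tree T₁ renaming (root to ρ; parent to π; E to E₁) hiding (Branching)
    bρ : Child b ρ
    bρ = root-child (to ab)
    b∈ : S b
    b∈ = proj₁ bρ
    b≢ρ : b ≢ ρ
    b≢ρ = proj₁ (proj₂ bρ)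
    πb : π b ≡ ρ
    πb = proj₂ (proj₂ bρ)
    S⇒≢r : ∀ {x} → S x → x ≢ r
    S⇒≢r x∈ refl = r∉ x∈
    r≢ρ : r ≢ ρ
    r≢ρ refl = r∉ root∈
    π′ : Fin n → Fin n
    π′ = updateAt (updateAt π b (const r)) r (const ρ)
    π′r : π′ r ≡ ρ
    π′r = updateAt-updates r _
    π′b : π′ b ≡ r
    π′b = trans (updateAt-minimal b r _ (S⇒≢r b∈)) (updateAt-updates b π)
    π′≡ : ∀ {x} → S x → x ≢ b → π′ x ≡ π x
    π′≡ {x} x∈ x≢b = trans (updateAt-minimal x r _ (S⇒≢r x∈)) (updateAt-minimal x b π x≢b)
    reach-r : Reach ρ π′ r
    reach-r = up r≢ρ (subst (Reach ρ π′) (sym π′r) here)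
    reach-old : ∀ {x} → S x → Reach ρ π x → Reach ρ π′ x
    reach-old x∈ here = here
    reach-old {x} x∈ (up x≢ q) with x ≟ b
    ... | yes refl = up x≢ (subst (Reach ρ π′) (sym π′b) reach-r)
    ... | no x≢b = up x≢ (subst (Reach ρ π′) (sym (π′≡ x∈ x≢b)) (reach-old (parent∈ x∈ x≢) q))
    parent∈′ : ∀ {x} → S⁺ x → x ≢ ρ → S⁺ (π′ x)
    parent∈′ (inj₂ refl) _ = inj₁ (subst S (sym π′r) root∈)
    parent∈′ {x} (inj₁ x∈) x≢ with x ≟ b
    ... | yes refl = inj₂ π′b
    ... | no x≢b = inj₁ (subst S (sym (π′≡ x∈ x≢b)) (parent∈ x∈ x≢))
    T′ : Tree S⁺
    T′ = record
      { root = ρ ; root∈ = inj₁ root∈ ; parent = π′ ; parent∈ = parent∈′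
      ; reach = λ { (inj₁ x∈) → reach-old x∈ (reach x∈) ; (inj₂ refl) → reach-r } }
    keep-child : ∀ {x y} → Child x y → ¬ SamePair ρ b x y → Tree.Child T′ x y
    keep-child {x} (x∈ , x≢ , refl) ¬ab with x ≟ b
    ... | yes refl = contradiction (inj₂ (refl , πb)) ¬ab
    ... | no x≢b = inj₁ x∈ , x≢ , π′≡ x∈ x≢b
    keep : ∀ {x y} → E T x y → ¬ SamePair ρ b x y → E T′ x y
    keep e ¬ab with to e
    ... | inj₁ c = inj₁ (keep-child c ¬ab)
    ... | inj₂ c = inj₂ (keep-child c (¬ab ∘ samePair-swap))
    Old : Fin n → Fin n → Set
    Old x y = (E T x y × ¬ SamePair ρ b x y) ⊎ SamePair r ρ x y ⊎ SamePair r b x y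
    back-child : ∀ {x y} → Tree.Child T′ x y → Old x y
    back-child (inj₂ refl , _ , refl) = inj₂ (inj₁ (inj₁ (refl , π′r)))
    back-child {x} (inj₁ x∈ , x≢ , refl) with x ≟ b
    ... | yes refl = inj₂ (inj₂ (inj₂ (refl , π′b)))
    ... | no x≢b = inj₁ (from (inj₁ (x∈ , x≢ , sym (π′≡ x∈ x≢b))) ,
                         λ { (inj₁ (x≡ρ , _)) → x≢ x≡ρ ; (inj₂ (x≡b , _)) → x≢b x≡b })
    back : ∀ {x y} → E T′ x y → Old x y
    back (inj₁ c) = back-child c
    back (inj₂ c) with back-child c
    ... | inj₁ (e , ¬ab) = inj₁ (swap e , ¬ab ∘ samePair-swap)
    ... | inj₂ (inj₁ s) = inj₂ (inj₁ (samePair-swap s))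
    ... | inj₂ (inj₂ s) = inj₂ (inj₂ (samePair-swap s))

-- Removing q and hanging its other neighbours on p.
bypass : ∀ {S : Fin n → Set} (T : Tree S) → ∀ {q p} → E T q p →
         Σ (Tree (λ x → S x × x ≢ q)) λ T′ →
         (∀ {x y} → E T x y → x ≢ q → y ≢ q → E T′ x y) ×
         (∀ {c} → E T q c → c ≢ p → E T′ c p) ×
         (∀ {x y} → E T′ x y → E T x y ⊎ (E T q x × E T q y))
bypass {S = S} T {q} {p} qp with reroot T (Tree.E-S T (Tree.E-sym T qp))
... | T₁ , refl , to , from = T′ , keep , hang , back
  where
  open Tree T₁ renaming (root to ρ; parent to π; E to E₁) hiding (Branching)
  qρ : Child q ρ
  qρ = root-child (E-sym (to qp))
  q≢ρ : q ≢ ρ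
  q≢ρ = proj₁ (proj₂ qρ)
  πq : π q ≡ ρ
  πq = proj₂ (proj₂ qρ)
  S⁻ : Fin _ → Set
  S⁻ x = S x × x ≢ q
  π′ : Fin _ → Fin _
  π′ x with π x ≟ q
  ... | yes _ = ρ
  ... | no _ = π x
  π′-q : ∀ {x} → π x ≡ q → π′ x ≡ ρ
  π′-q {x} eq with π x ≟ q
  ... | yes _ = refl
  ... | no ¬eq = contradiction eq ¬eq
  π′-≢ : ∀ {x} → π x ≢ q → π′ x ≡ π x
  π′-≢ {x} ¬eq with π x ≟ q
  ... | yes eq = contradiction eq ¬eq
  ... | no _ = refl
  ρ∈ : S⁻ ρ
  ρ∈ = root∈ , q≢ρ ∘ sym
  reach′ : ∀ {x} → Reach ρ π x → Reach ρ π′ x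
  reach′ here = here
  reach′ {x} (up x≢ r) with π x ≟ q
  ... | yes eq = up x≢ (subst (Reach ρ π′) (sym (π′-q eq)) here)
  ... | no ¬eq = up x≢ (subst (Reach ρ π′) (sym (π′-≢ ¬eq)) (reach′ r))
  parent∈′ : ∀ {x} → S⁻ x → x ≢ ρ → S⁻ (π′ x)
  parent∈′ {x} (x∈ , _) x≢ with π x ≟ q
  ... | yes _ = ρ∈
  ... | no ¬eq = parent∈ x∈ x≢ , ¬eq
  T′ : Tree S⁻
  T′ = record { root = ρ ; root∈ = ρ∈ ; parent = π′ ; parent∈ = parent∈′
              ; reach = λ (x∈ , _) → reach′ (reach x∈) }
  keep-child : ∀ {x y} → Child x y → x ≢ q → y ≢ q → Tree.Child T′ x y
  keep-child (x∈ , x≢ , refl) x≢q y≢q = (x∈ , x≢q) , x≢ , π′-≢ y≢q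
  keep : ∀ {x y} → E T x y → x ≢ q → y ≢ q → E T′ x y
  keep e x≢q y≢q with to e
  ... | inj₁ c = inj₁ (keep-child c x≢q y≢q)
  ... | inj₂ c = inj₂ (keep-child c y≢q x≢q)
  hang : ∀ {c} → E T q c → c ≢ ρ → E T′ c ρ
  hang e c≢ρ with to e
  ... | inj₁ (_ , _ , refl) = contradiction πq c≢ρ
  ... | inj₂ (c∈ , c≢ , πc) = inj₁ ((c∈ , λ { refl → q≢ρ (trans (sym πc) πq) }) , c≢ , π′-q πc)
  back-child : ∀ {x y} → Tree.Child T′ x y → E T x y ⊎ (E T q x × E T q y)
  back-child {x} ((x∈ , x≢q) , x≢ , refl) with π x ≟ q
  ... | yes eq = inj₂ (from (inj₂ (x∈ , x≢ , eq)) , qp)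
  ... | no ¬eq = inj₁ (from (inj₁ (x∈ , x≢ , refl)))
  back : ∀ {x y} → E T′ x y → E T x y ⊎ (E T q x × E T q y)
  back (inj₁ c) = back-child c
  back (inj₂ c) with back-child c
  ... | inj₁ e = inj₁ (Tree.E-sym T e)
  ... | inj₂ (e , f) = inj₂ (f , e)

samePair? : (a b u v : Fin n) → Dec (SamePair a b u v)
samePair? a b u v = ((u ≟ a) ×-dec (v ≟ b)) ⊎-dec ((u ≟ b) ×-dec (v ≟ a))

samePair-unique : ∀ {a b u v w : Fin n} → SamePair a b u v → SamePair a b u w → v ≡ w
samePair-unique (inj₁ (refl , refl)) (inj₁ (_ , refl)) = refl
samePair-unique (inj₁ (refl , refl)) (inj₂ (refl , refl)) = refl
samePair-unique (inj₂ (refl , refl)) (inj₁ (refl , refl)) = refl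
samePair-unique (inj₂ (refl , refl)) (inj₂ (_ , refl)) = refl

branching-other : ∀ {S : Fin n → Set} (T : Tree S) {x} → Branching T x → ∀ y → ∃ λ z → z ≢ y × E T x z
branching-other T (a , b , a≢b , xa , xb) y with a ≟ y
... | yes refl = b , a≢b ∘ sym , xb
... | no a≢y = a , a≢y , xa

-- A vertex that loses its neighbour `q` gains `p` instead, and `p` itself gains another neighbour
-- of `q`, which exists as `q` is branching. The gained neighbour is new because the tree has no
-- triangle.
bypass-branching : ∀ {S : Fin n → Set} (T : Tree S) {q p} → E T q p → Branching T q →
  (T′ : Tree (λ x → S x × x ≢ q)) → (∀ {x y} → E T x y → x ≢ q → y ≢ q → E T′ x y) →
  (∀ {c} → E T q c → c ≢ p → E T′ c p) → ∀ {x} → x ≢ q → Branching T x → Branching T′ x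
bypass-branching T {q} {p} qp branching-q T′ keep hang {x} x≢q (y , z , y≢z , xy , xz) = result
  where
  replace : E T x q → ∃ λ w → E T′ x w × ∀ {v} → E T x v → w ≢ v
  replace xq with x ≟ p
  ... | yes refl = let c , c≢p , qc = branching-other T branching-q p in
        c , Tree.E-sym T′ (hang qc c≢p) , λ { xc refl → Tree.E-triangle-free T xq qc xc }
  ... | no x≢p = p , hang (Tree.E-sym T xq) x≢p , λ { xv refl → Tree.E-triangle-free T xq qp xv }
  result : Branching T′ x
  result with y ≟ q | z ≟ q
  ... | yes refl | yes refl = contradiction refl y≢z
  ... | yes refl | no z≢q = let w , xw , new = replace xy in w , z , new xz , xw , keep xz x≢q z≢q
  ... | no y≢q | yes refl = let w , xw , new = replace xz in w , y , new xy , xw , keep xy x≢q y≢q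
  ... | no y≢q | no z≢q = y , z , y≢z , keep xy x≢q y≢q , keep xz x≢q z≢q

Within : (G : Graph n) {S : Fin n → Set} → Tree S → Set
Within G T = ∀ {x y} → E T x y → Adj G x y

-- One tree edge, `ab`, may be missing from `G`. Subdividing it by a neighbour `r` of `a` moves the
-- defect to `rb`, so vertices can be inserted in a row.
WithinBut : (G : Graph n) {S : Fin n → Set} → Tree S → Fin n → Fin n → Set
WithinBut G T a b = ∀ {x y} → E T x y → ¬ SamePair a b x y → Adj G x y

insert : (G : Graph n) {S : Fin n → Set} (T : Tree S) → ∀ {a b r} → ¬ S r → E T a b →
         WithinBut G T a b → Adj G r a →
         Σ (Tree (λ x → S x ⊎ x ≡ r)) λ T′ → E T′ r b × WithinBut G T′ r b × Branching T′ r ×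
           (∀ {x} → Branching T x → Branching T′ x)
insert G T {a} {b} {r} r∉ ab but ra
  with subdivide T r∉ ab
... | T′ , keep , ra′ , br′ , back =
  T′ , E-sym br′ , but′ , (a , b , (λ { refl → Tree.E-irrefl T ab }) , ra′ , E-sym br′) , branching
  where
  open Tree T′ using (E-sym)
  but′ : WithinBut G T′ r b
  but′ e ¬rb with back e
  ... | inj₁ (e′ , ¬ab) = but e′ ¬ab
  ... | inj₂ (inj₁ (inj₁ (refl , refl))) = ra
  ... | inj₂ (inj₁ (inj₂ (refl , refl))) = N-sym G ra
  ... | inj₂ (inj₂ s) = contradiction s ¬rb
  to-r : ∀ {x y} → SamePair a b x y → E T′ x r
  to-r (inj₁ (refl , refl)) = E-sym ra′
  to-r (inj₂ (refl , refl)) = br′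
  new : ∀ {x y} → E T x y → r ≢ y
  new xy refl = r∉ (Tree.E-S T (Tree.E-sym T xy))
  branching : ∀ {x} → Branching T x → Branching T′ x
  branching {x} (y , z , y≢z , xy , xz) with samePair? a b x y | samePair? a b x z
  ... | yes s | yes t = contradiction (samePair-unique s t) y≢z
  ... | yes s | no ¬t = r , z , new xz , to-r s , keep xz ¬t
  ... | no ¬s | yes t = r , y , new xy , to-r t , keep xy ¬s
  ... | no ¬s | no ¬t = y , z , y≢z , keep xy ¬s , keep xz ¬t

but-within : (G : Graph n) {S : Fin n → Set} (T : Tree S) → ∀ {a b} → Adj G a b →
             WithinBut G T a b → Within G T
but-within G T {a} {b} ab but {x} {y} e with samePair? a b x y
... | no ¬s = but e ¬s
... | yes (inj₁ (refl , refl)) = ab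
... | yes (inj₂ (refl , refl)) = N-sym G ab

-- The edge along which two neighbours of a simplicial vertex are put back

Off : Graph n → Fin n → Fin n → Set
Off G r x = x ≢ r × ¬ Adj G r x

module _ (G : Graph n) (chordal : Chordal G) (claw-free : ClawFree G) where

  third-edge : ∀ {x a b c} → Adj G x a → Adj G x b → Adj G x c → a ≢ b → a ≢ c → b ≢ c →
               ¬ Adj G a b → ¬ Adj G a c → Adj G b c
  third-edge xa xb xc a≢b a≢c b≢c ¬ab ¬ac with claw-free xa xb xc a≢b a≢c b≢c
  ... | inj₁ ab = contradiction ab ¬ab
  ... | inj₂ (inj₁ ac) = contradiction ac ¬ac
  ... | inj₂ (inj₂ bc) = bc

  private-clique : ∀ {r q y z} → Adj G r q → Off G r y → Off G r z → Adj G q y → Adj G q z → y ≢ z → Adj G y z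
  private-clique rq (y≢r , ¬ry) (z≢r , ¬rz) qy qz y≢z =
    third-edge (N-sym G rq) qy qz (y≢r ∘ sym) (z≢r ∘ sym) y≢z ¬ry ¬rz

  module _ {r q₁ q₂} (rq₁ : Adj G r q₁) (rq₂ : Adj G r q₂) (q₁q₂ : Adj G q₁ q₂)
           {L : Fin n → Fin n → Set} (L-sym : ∀ {x y} → L x y → L y x)
           (L-adj : ∀ {x y} → L x y → Adj G x y) (L-off : ∀ {x y} → L x y → Off G r x) where

    private
      Far? : ∀ x → Dec (¬ Adj G q₁ x × x ≢ q₁)
      Far? x = ¬? (x ∈? N G q₁) ×-dec ¬? (x ≟ q₁)

      Far : Subset n
      Far = ⟪ Far? ⟫

      off≢ : ∀ {q x} → Adj G r q → Off G r x → x ≢ q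
      off≢ rq (_ , ¬rx) refl = ¬rx rq

      -- Here `z` is the last vertex of the walk adjacent to `q₁`; everything after it stays in
      -- `Far`.
      Last : Fin n → Set
      Last b = ∃ λ z → Adj G q₁ z × (z ≡ b ⊎ ∃ λ z′ → L z z′ × Walk G Far z′ b)

      scan : ∀ {a b} → Off G r b → Star L a b → Walk G Far a b ⊎ Last b
      scan {b = b} off-b ε with b ∈? N G q₁
      ... | yes q₁b = inj₂ (b , q₁b , inj₁ refl)
      ... | no ¬q₁b = inj₁ [ ∈-⟪⟫⁺ Far? (¬q₁b , off≢ rq₁ off-b) ]
      scan {a} off-b (e ◅ es) with scan off-b es
      ... | inj₂ found = inj₂ found
      ... | inj₁ p with a ∈? N G q₁
      ...   | yes q₁a = inj₂ (a , q₁a , inj₂ (_ , e , p))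
      ...   | no ¬q₁a = inj₁ (∈-⟪⟫⁺ Far? (¬q₁a , off≢ rq₁ (L-off e)) ⟨ L-adj e ⟩ p)

    -- The last vertex z of the walk adjacent to q₁ is adjacent to q₂ by chordality, and claws at z
    -- make the next vertex adjacent to q₂ as well.
    link : ∀ {w₂ w₁ u₁ u₂} → L w₂ w₁ → Star L w₁ u₁ → L u₁ u₂ →
           Adj G q₁ w₁ → Adj G q₁ w₂ → Adj G q₂ u₁ → Adj G q₂ u₂ →
           ∃ λ z → ∃ λ z′ → L z z′ × Adj G q₁ z × Adj G q₂ z′
    link {w₂} {w₁} {u₁} {u₂} w₂w₁ path u₁u₂ q₁w₁ q₁w₂ q₂u₁ q₂u₂
      with u₂ ∈? N G q₁ | w₂ ∈? N G q₂
    ... | yes q₁u₂ | _ = u₂ , u₁ , L-sym u₁u₂ , q₁u₂ , q₂u₁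
    ... | no _ | yes q₂w₂ = w₁ , w₂ , L-sym w₂w₁ , q₁w₁ , q₂w₂
    ... | no ¬q₁u₂ | no ¬q₂w₂ with scan (L-off (L-sym u₁u₂)) (w₂w₁ ◅ path ◅◅ u₁u₂ ◅ ε)
    ...   | inj₁ p = contradiction q₁w₂ (proj₁ (∈-⟪⟫⁻ Far? (head∈ p)))
    ...   | inj₂ (z , q₁z , inj₁ refl) = contradiction q₁z ¬q₁u₂
    ...   | inj₂ (z , q₁z , inj₂ (z′ , zz′ , p)) = z , z′ , zz′ , q₁z , q₂z′
      where
      off-z = L-off zz′
      off-u₂ = L-off (L-sym u₁u₂)
      off-w₂ = L-off w₂w₁
      ¬q₁z′ : ¬ Adj G q₁ z′
      ¬q₁z′ = proj₁ (∈-⟪⟫⁻ Far? (head∈ p))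
      z≢u₂ : z ≢ u₂
      z≢u₂ refl = ¬q₁u₂ q₁z
      Y = Far ∪ ⁅ z ⁆
      q₁∉Y : q₁ ∉ Y
      q₁∉Y q₁∈ with x∈p∪⁅y⁆⁻ Far z q₁∈
      ... | inj₁ q₁∈Far = proj₂ (∈-⟪⟫⁻ Far? q₁∈Far) refl
      ... | inj₂ refl = N-irrefl G q₁z
      q₂∉Y : q₂ ∉ Y
      q₂∉Y q₂∈ with x∈p∪⁅y⁆⁻ Far z q₂∈
      ... | inj₁ q₂∈Far = proj₁ (∈-⟪⟫⁻ Far? q₂∈Far) q₁q₂
      ... | inj₂ refl = proj₂ off-z rq₂
      q₂z : Adj G q₂ z
      q₂z with common-neighbour chordal q₁∉Y q₂∉Y q₁q₂ q₁z q₂u₂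
                 (y∈p∪⁅y⁆ Far z ⟨ L-adj zz′ ⟩ mono (p⊆p∪⁅y⁆ Far z) p)
      ... | x , x∈ , q₁x , q₂x with x∈p∪⁅y⁆⁻ Far z x∈
      ...   | inj₁ x∈Far = contradiction q₁x (proj₁ (∈-⟪⟫⁻ Far? x∈Far))
      ...   | inj₂ refl = q₂x
      zu₂ : Adj G z u₂
      zu₂ = private-clique rq₂ off-z off-u₂ q₂z q₂u₂ z≢u₂
      zw₂ : Adj G z w₂
      zw₂ = private-clique rq₁ off-z off-w₂ q₁z q₁w₂ λ { refl → ¬q₂w₂ q₂z }
      q₂z′ : Adj G q₂ z′
      q₂z′ = decidable-stable (z′ ∈? N G q₂) λ ¬q₂z′ → no-hole ¬q₂z′
        where
        module _ (¬q₂z′ : ¬ Adj G q₂ z′) where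
          z′u₂ : Adj G z′ u₂
          z′u₂ = third-edge (N-sym G q₁z) (L-adj zz′) zu₂
                   (off≢ rq₁ (L-off (L-sym zz′)) ∘ sym) (off≢ rq₁ off-u₂ ∘ sym) (λ { refl → ¬q₂z′ q₂u₂ })
                   ¬q₁z′ ¬q₁u₂
          z′w₂ : Adj G z′ w₂
          z′w₂ = third-edge (N-sym G q₂z) (L-adj zz′) zw₂
                   (off≢ rq₂ (L-off (L-sym zz′)) ∘ sym) (off≢ rq₂ off-w₂ ∘ sym) (λ { refl → ¬q₁z′ q₁w₂ })
                   ¬q₂z′ ¬q₂w₂
          -- Chordality puts the edge `q₁q₂` of the closed walk `q₁ w₂ z′ u₂ q₂` in a triangle, with
          -- apex in any set that contains `w₂`, `z′`, `u₂` and avoids `q₁`, `q₂`. None of the three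
          -- is adjacent to both ends, so a set without common neighbours of `q₁` and `q₂` will do.
          P? : ∀ x → Dec (Off G r x × ¬ (Adj G q₁ x × Adj G q₂ x))
          P? x = (¬? (x ≟ r) ×-dec ¬? (x ∈? N G r)) ×-dec ¬? ((x ∈? N G q₁) ×-dec (x ∈? N G q₂))
          ∈P : ∀ {x} → Off G r x → ¬ (Adj G q₁ x × Adj G q₂ x) → x ∈ ⟪ P? ⟫
          ∈P off ¬both = ∈-⟪⟫⁺ P? (off , ¬both)
          no-hole : ⊥
          no-hole =
            let x , x∈ , both = common-neighbour {G = G} chordal {⟪ P? ⟫}
                  (λ q₁∈ → proj₂ (proj₁ (∈-⟪⟫⁻ P? q₁∈)) rq₁) (λ q₂∈ → proj₂ (proj₁ (∈-⟪⟫⁻ P? q₂∈)) rq₂)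
                  q₁q₂ q₁w₂ q₂u₂
                  (∈P off-w₂ (¬q₂w₂ ∘ proj₂) ⟨ N-sym G z′w₂ ⟩
                   edge (∈P (L-off (L-sym zz′)) (¬q₁z′ ∘ proj₁)) (∈P off-u₂ (¬q₁u₂ ∘ proj₁)) z′u₂)
            in proj₂ (∈-⟪⟫⁻ P? x∈) both

-- Spanning trees with prescribed leaves

-- A spanning tree of G[S] whose leaves lie in Z.
SpansBut : (G : Graph n) → Subset n → Subset n → Set
SpansBut G S Z = Σ (Tree (_∈ S)) λ T → Within G T × (∀ {x} → x ∈ S → x ∉ Z → Branching T x)

module _ (G : Graph n) (chordal : Chordal G) (claw-free : ClawFree G) where

  -- The possibly missing edge is `q₁z′`, then `rz′`, then `q₂z′`, and the last one is an edge of
  -- `G`.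
  insert₃ : ∀ {S : Fin n → Set} (T : Tree S) → Within G T → ∀ {q₁ r q₂ z z′} →
            ¬ S q₁ → ¬ S r → ¬ S q₂ → r ≢ q₁ → q₂ ≢ q₁ → q₂ ≢ r →
            E T z z′ → Adj G q₁ z → Adj G r q₁ → Adj G q₂ r → Adj G q₂ z′ →
            Σ (Tree (λ x → ((S x ⊎ x ≡ q₁) ⊎ x ≡ r) ⊎ x ≡ q₂)) λ T′ → Within G T′ ×
              Branching T′ q₁ × Branching T′ r × Branching T′ q₂ × (∀ {x} → Branching T x → Branching T′ x)
  insert₃ T within q₁∉ r∉ q₂∉ r≢q₁ q₂≢q₁ q₂≢r zz′ q₁z rq₁ q₂r q₂z′
    with insert G T q₁∉ zz′ (λ e _ → within e) q₁z
  ... | T₁ , e₁ , but₁ , b₁ , keep₁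
    with insert G T₁ [ r∉ , r≢q₁ ]′ e₁ but₁ rq₁
  ... | T₂ , e₂ , but₂ , b₂ , keep₂
    with insert G T₂ [ [ q₂∉ , q₂≢q₁ ]′ , q₂≢r ]′ e₂ but₂ q₂r
  ... | T₃ , e₃ , but₃ , b₃ , keep₃ =
    T₃ , but-within G T₃ q₂z′ but₃ , keep₃ (keep₂ b₁) , keep₃ b₂ , b₃ , λ b → keep₃ (keep₂ (keep₁ b))

  module _ {S Z : Subset n} {r : Fin n} (r∈ : r ∈ S) (sim : Simplicial G S r)
           (Z-simplicial : ∀ {z} → z ∈ Z → Simplicial G S z) where

    private
      S⁻ : Fin n → Set
      S⁻ = _∈ (S - r)

      S⁻⊆S : ∀ {x} → S⁻ x → x ∈ S
      S⁻⊆S = p-x⊆p S r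

      S⁻≢ : ∀ {x} → S⁻ x → x ≢ r
      S⁻≢ = x∈p-y⇒x≢y S

    insert-simplicial : (T : Tree S⁻) → Within G T → (∀ {x} → S⁻ x → x ∉ Z → Branching T x) →
                        ∀ {a b} → E T a b → Adj G r a → Adj G r b → SpansBut G S Z
    insert-simplicial T within branching {a} {b} ab ra rb
      with insert G T (λ r∈⁻ → S⁻≢ r∈⁻ refl) ab (λ e _ → within e) ra
    ... | T₁ , e₁ , but₁ , b₁ , keep₁ with transport to from T₁
      where
      to : ∀ {x} → S⁻ x ⊎ x ≡ r → x ∈ S
      to (inj₁ x∈) = S⁻⊆S x∈
      to (inj₂ refl) = r∈
      from : ∀ {x} → x ∈ S → S⁻ x ⊎ x ≡ r
      from {x} x∈ with x ≟ r
      ... | yes x≡r = inj₂ x≡r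
      ... | no x≢r = inj₁ (x∈p∧x≢y⇒x∈p-y x∈ x≢r)
    ...   | T₂ , to , from = T₂ , (λ e → but-within G T₁ rb but₁ (from e)) , branching′
      where
      lift : ∀ {x} → Branching T₁ x → Branching T₂ x
      lift (y , z , y≢z , xy , xz) = y , z , y≢z , to xy , to xz
      branching′ : ∀ {x} → x ∈ S → x ∉ Z → Branching T₂ x
      branching′ {x} x∈ x∉ with x ≟ r
      ... | yes refl = lift b₁
      ... | no x≢r = lift (keep₁ (branching (x∈p∧x≢y⇒x∈p-y x∈ x≢r) x∉))

    module _ (T : Tree S⁻) (within : Within G T) (branching : ∀ {x} → S⁻ x → x ∉ Z → Branching T x)
             (rρ : Adj G r (Tree.root T)) (apart : ∀ {a b} → E T a b → Adj G r a → ¬ Adj G r b) where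

      open Tree T using (E-sym; E-S; parent; parent∈; reach) renaming (root to q₁; root∈ to q₁∈)

      OffEdge : Fin n → Fin n → Set
      OffEdge x y = E T x y × Off G r x × Off G r y

      Nearby : Set
      Nearby = ∃ λ q₂ → ∃ λ u₁ → ∃ λ w₁ →
               q₂ ≢ q₁ × Adj G r q₂ × E T q₂ u₁ × E T q₁ w₁ × Star OffEdge u₁ w₁

      off : ∀ {x} → S⁻ x → ¬ Adj G r x → Off G r x
      off x∈ ¬rx = S⁻≢ x∈ , ¬rx

      -- On the way up to the root `q₁`, the neighbour of `r` nearest to the root, other than the
      -- root, is the required `q₂`. In the first alternative none has been met from `x` upwards.
      climb : ∀ {x} → S⁻ x → x ≢ q₁ → Reach q₁ parent x →
              (Off G r x × ∃ λ w₁ → E T q₁ w₁ × Star OffEdge x w₁) ⊎ Nearby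
      climb x∈ x≢ here = contradiction refl x≢
      climb {x} x∈ _ (up x≢ p) with parent x ≟ q₁
      ... | yes eq = inj₁ (off x∈ (λ rx → apart xq₁ rx rρ) , x , E-sym xq₁ , ε)
        where
        xq₁ : E T x q₁
        xq₁ = inj₁ (x∈ , x≢ , eq)
      ... | no ≢q₁ with climb (parent∈ x∈ x≢) ≢q₁ p
      ...   | inj₂ found = inj₂ found
      ...   | inj₁ (off-y , w₁ , e , path) with x ∈? N G r
      ...     | yes rx = inj₂ (x , parent x , w₁ , x≢ , rx , inj₁ (x∈ , x≢ , refl) , e , path)
      ...     | no ¬rx = inj₁ (off x∈ ¬rx , w₁ , e , (inj₁ (x∈ , x≢ , refl) , off x∈ ¬rx , off-y) ◅ path)

      nearby : ∀ {q} → S⁻ q → q ≢ q₁ → Adj G r q → Nearby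
      nearby q∈ q≢q₁ rq with climb q∈ q≢q₁ (reach q∈)
      ... | inj₁ ((_ , ¬rq) , _) = contradiction rq ¬rq
      ... | inj₂ found = found

      -- A marked `q` is simplicial, so its neighbours `r` and `y` would be adjacent, although no
      -- tree edge joins two neighbours of `r`. Hence `q` is unmarked.
      neighbour-branching : ∀ {q y} → Adj G r q → E T q y → Branching T q
      neighbour-branching {q} {y} rq qy with q ∈? Z
      ... | no q∉ = branching (E-S qy) q∉
      ... | yes q∈ with Z-simplicial q∈ r∈ (S⁻⊆S (E-S (E-sym qy))) (N-sym G rq) (within qy)
      ...   | inj₁ refl = contradiction refl (S⁻≢ (E-S (E-sym qy)))
      ...   | inj₂ ry = contradiction ry (apart qy rq)

      neighbour-off : ∀ {q y} → Adj G r q → E T q y → Off G r y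
      neighbour-off rq qy = off (E-S (E-sym qy)) (apart qy rq)

      -- By claw-freeness the tree neighbours of q₁ form a clique, as do those of q₂. So both can be
      -- bypassed and put back, with r between them, along a single edge.
      reroute : Nearby → SpansBut G S Z
      reroute (q₂ , u₁ , w₁ , q₂≢q₁ , rq₂ , q₂u₁ , q₁w₁ , path)
        with branching-other T (neighbour-branching rρ q₁w₁) w₁
           | branching-other T (neighbour-branching rq₂ q₂u₁) u₁
      ... | w₂ , w₂≢w₁ , q₁w₂ | u₂ , u₂≢u₁ , q₂u₂
        with bypass T q₁w₂ | bypass-branching T q₁w₂ (neighbour-branching rρ q₁w₁)
      ... | T₁ , keep₁ , hang₁ , back₁ | b₁
        with bypass T₁ (keep₁ q₂u₂ q₂≢q₁ (≢q₁ (neighbour-off rq₂ q₂u₂)))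
           | bypass-branching T₁ (keep₁ q₂u₂ q₂≢q₁ (≢q₁ (neighbour-off rq₂ q₂u₂)))
               (b₁ T₁ keep₁ hang₁ q₂≢q₁ (neighbour-branching rq₂ q₂u₁))
        where
        ≢q₁ : ∀ {x} → Off G r x → x ≢ q₁
        ≢q₁ (_ , ¬rx) refl = ¬rx rρ
      ... | T₂ , keep₂ , hang₂ , back₂ | b₂ = result
        where
        ≢q₁ : ∀ {x} → Off G r x → x ≢ q₁
        ≢q₁ (_ , ¬rx) refl = ¬rx rρ
        ≢q₂ : ∀ {x} → Off G r x → x ≢ q₂
        ≢q₂ (_ , ¬rx) refl = ¬rx rq₂
        keep : ∀ {x y} → E T x y → Off G r x → Off G r y → E T₂ x y
        keep e off-x off-y = keep₂ (keep₁ e (≢q₁ off-x) (≢q₁ off-y)) (≢q₂ off-x) (≢q₂ off-y)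
        off-w₁ = neighbour-off rρ q₁w₁
        off-w₂ = neighbour-off rρ q₁w₂
        off-u₁ = neighbour-off rq₂ q₂u₁
        off-u₂ = neighbour-off rq₂ q₂u₂
        from₁ : ∀ {y} → E T₁ q₂ y → E T q₂ y
        from₁ e with back₁ e
        ... | inj₁ e′ = e′
        ... | inj₂ (q₁q₂ , _) = contradiction rq₂ (apart q₁q₂ rρ)
        within₁ : Within G T₁
        within₁ {x} {y} e with back₁ e
        ... | inj₁ e′ = within e′
        ... | inj₂ (q₁x , q₁y) =
              private-clique G chordal claw-free rρ (neighbour-off rρ q₁x) (neighbour-off rρ q₁y)
                (within q₁x) (within q₁y) (λ { refl → Tree.E-irrefl T₁ e })
        within₂ : Within G T₂
        within₂ {x} {y} e with back₂ e
        ... | inj₁ e′ = within₁ e′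
        ... | inj₂ (q₂x , q₂y) =
              private-clique G chordal claw-free rq₂ (neighbour-off rq₂ (from₁ q₂x))
                (neighbour-off rq₂ (from₁ q₂y)) (within (from₁ q₂x)) (within (from₁ q₂y))
                (λ { refl → Tree.E-irrefl T₂ e })
        L : Fin n → Fin n → Set
        L x y = E T₂ x y × Off G r x × Off G r y
        q₂≢r : q₂ ≢ r
        q₂≢r = S⁻≢ (E-S q₂u₁)
        q₁q₂ : Adj G q₁ q₂
        q₁q₂ with sim (S⁻⊆S q₁∈) (S⁻⊆S (E-S q₂u₁)) rρ rq₂
        ... | inj₁ eq = contradiction (sym eq) q₂≢q₁
        ... | inj₂ a = a
        linked : ∃ λ z → ∃ λ z′ → L z z′ × Adj G q₁ z × Adj G q₂ z′
        -- After the two bypasses `w₁` hangs on `w₂` and `u₁` on `u₂`, so the old path between `w₁`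
        -- and `u₁` extends to a walk from `w₂` to `u₂` away from `r`.
        linked = link G chordal claw-free rρ rq₂ q₁q₂ {L}
          (λ (e , o , o′) → Tree.E-sym T₂ e , o′ , o) (λ (e , _) → within₂ e) (λ (_ , o , _) → o)
          (keep₂ (Tree.E-sym T₁ (hang₁ q₁w₁ (w₂≢w₁ ∘ sym))) (≢q₂ off-w₂) (≢q₂ off-w₁) , off-w₂ , off-w₁)
          (Star.reverse (λ (e , o , o′) → Tree.E-sym T₂ e , o′ , o)
            (Star.map (λ (e , o , o′) → keep e o o′ , o , o′) path))
          (hang₂ (keep₁ q₂u₁ q₂≢q₁ (≢q₁ off-u₁)) (u₂≢u₁ ∘ sym) , off-u₁ , off-u₂)
          (within q₁w₁) (within q₁w₂) (within q₂u₁) (within q₂u₂)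
        S₂ : Fin n → Set
        S₂ x = (S⁻ x × x ≢ q₁) × x ≢ q₂
        S₃ : Fin n → Set
        S₃ x = ((S₂ x ⊎ x ≡ q₁) ⊎ x ≡ r) ⊎ x ≡ q₂
        to : ∀ {x} → S₃ x → x ∈ S
        to (inj₁ (inj₁ (inj₁ ((x∈ , _) , _)))) = S⁻⊆S x∈
        to (inj₁ (inj₁ (inj₂ refl))) = S⁻⊆S q₁∈
        to (inj₁ (inj₂ refl)) = r∈
        to (inj₂ refl) = S⁻⊆S (E-S q₂u₁)
        cases : ∀ {x} → x ∈ S → S₃ x
        cases {x} x∈ with x ≟ q₁ | x ≟ r | x ≟ q₂
        ... | yes x≡ | _ | _ = inj₁ (inj₁ (inj₂ x≡))
        ... | no _ | yes x≡ | _ = inj₁ (inj₂ x≡)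
        ... | no _ | no _ | yes x≡ = inj₂ x≡
        ... | no x≢q₁ | no x≢r | no x≢q₂ =
              inj₁ (inj₁ (inj₁ ((x∈p∧x≢y⇒x∈p-y x∈ x≢r , x≢q₁) , x≢q₂)))
        assemble : (Σ (Tree S₃) λ T₃ → Within G T₃ × Branching T₃ q₁ × Branching T₃ r ×
                      Branching T₃ q₂ × (∀ {x} → Branching T₂ x → Branching T₃ x)) → SpansBut G S Z
        assemble (T₃ , within₃ , bq₁ , br , bq₂ , b₃) with transport to cases T₃
        ... | T₄ , to₄ , from₄ = T₄ , (λ e → within₃ (from₄ e)) , (λ x∈ x∉ → lift (branching₃ x∉ (cases x∈)))
          where
          lift : ∀ {x} → Branching T₃ x → Branching T₄ x
          lift (y , z , y≢z , xy , xz) = y , z , y≢z , to₄ xy , to₄ xz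
          branching₃ : ∀ {x} → x ∉ Z → S₃ x → Branching T₃ x
          branching₃ x∉ (inj₁ (inj₁ (inj₁ ((x∈ , x≢q₁) , x≢q₂)))) =
            b₃ (b₂ T₂ keep₂ hang₂ x≢q₂ (b₁ T₁ keep₁ hang₁ x≢q₁ (branching x∈ x∉)))
          branching₃ x∉ (inj₁ (inj₁ (inj₂ refl))) = bq₁
          branching₃ x∉ (inj₁ (inj₂ refl)) = br
          branching₃ x∉ (inj₂ refl) = bq₂
        result : SpansBut G S Z
        result =
          let z , z′ , (zz′ , _) , q₁z , q₂z′ = linked in
          assemble (insert₃ T₂ within₂ (λ ((_ , ≢q₁) , _) → ≢q₁ refl) (λ ((r∈⁻ , _) , _) → S⁻≢ r∈⁻ refl)
            (λ (_ , ≢q₂) → ≢q₂ refl) (S⁻≢ q₁∈ ∘ sym) q₂≢q₁ q₂≢r zz′ q₁z rρ (N-sym G rq₂) q₂z′)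

    reinsert : ∀ {q q′} → S⁻ q → S⁻ q′ → q ≢ q′ → Adj G r q → Adj G r q′ → SpansBut G (S - r) Z → SpansBut G S Z
    reinsert {q} {q′} q∈ q′∈ q≢q′ rq rq′ (T₀ , within₀ , branching₀) with reroot T₀ q∈
    ... | T , refl , to , from =
      decide (any? λ a → any? λ b → E? a b ×-dec (a ∈? N G r) ×-dec (b ∈? N G r))
      where
      within : Within G T
      within e = within₀ (from e)
      branching : ∀ {x} → S⁻ x → x ∉ Z → Branching T x
      branching x∈ x∉ = let y , z , y≢z , xy , xz = branching₀ x∈ x∉ in y , z , y≢z , to xy , to xz
      Child? : ∀ a b → Dec (Tree.Child T a b)
      Child? a b = (a ∈? (S - r)) ×-dec ¬? (a ≟ Tree.root T) ×-dec (Tree.parent T a ≟ b)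
      E? : ∀ a b → Dec (E T a b)
      E? a b = Child? a b ⊎-dec Child? b a
      decide : Dec (∃ λ a → ∃ λ b → E T a b × Adj G r a × Adj G r b) → SpansBut G S Z
      decide (yes (a , b , ab , ra , rb)) = insert-simplicial T within branching ab ra rb
      decide (no none) = reroute T within branching rq apart
        (nearby T within branching rq apart q′∈ (q≢q′ ∘ sym) rq′)
        where
        apart : ∀ {a b} → E T a b → Adj G r a → ¬ Adj G r b
        apart ab ra rb = none (_ , _ , ab , ra , rb)

-- Every component of S - c contains an element of Z, for every vertex c.
Blocking : Graph n → Subset n → Subset n → Set
Blocking G S Z = ∀ {c u} → u ∈ S → u ≢ c → ∃ λ z → z ∈ Z × Walk G (S - c) u z

p-x-y⊆p-y-x : ∀ (p : Subset n) x y → p - x - y ⊆ p - y - x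
p-x-y⊆p-y-x p x y = subst (_ ∈_) (p─x─y≡p─y─x p x y)

singleton-tree : (G : Graph n) {S Z : Subset n} → ∀ {r} → r ∈ S → r ∈ Z →
                 (∀ {x} → x ∈ S → x ≡ r) → SpansBut G S Z
singleton-tree G {S} {Z} {r} r∈ r∈Z only with transport {S′ = _∈ S} (λ { refl → r∈ }) only (single r)
... | T , to , from = T , (λ e → loop (from e)) , λ x∈ x∉ → contradiction (subst (_∈ Z) (sym (only x∈)) r∈Z) x∉
  where
  loop : ∀ {x y} → E (single r) x y → Adj G x y
  loop (inj₁ (x≡r , x≢r , _)) = contradiction x≡r x≢r
  loop (inj₂ (x≡r , x≢r , _)) = contradiction x≡r x≢r

-- The vertex `q` may be a leaf before `r` is attached: `r` is its second neighbour, and the first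
-- exists as soon as the smaller tree has another vertex.
attach-leaf : (G : Graph n) {S Z Z′ : Subset n} → ∀ {r q} → r ∈ S → r ∈ Z → q ∈ S - r → Adj G r q →
              (q ∉ Z → ∃ λ x → x ∈ S - r × x ≢ q) → (∀ {x} → x ∉ Z → x ≢ q → x ∉ Z′) →
              SpansBut G (S - r) Z′ → SpansBut G S Z
attach-leaf G {S} {Z} {Z′} {r} {q} r∈ r∈Z q∈ rq other Z′⊆ (T , within , branching)
  with attach T {r} (λ r∈⁻ → x∈p-y⇒x≢y S r∈⁻ refl) q∈
... | T₁ , keep , rq′ , back with transport to from T₁
  where
  to : ∀ {x} → x ∈ S - r ⊎ x ≡ r → x ∈ S
  to (inj₁ x∈) = p-x⊆p S r x∈
  to (inj₂ refl) = r∈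
  from : ∀ {x} → x ∈ S → x ∈ S - r ⊎ x ≡ r
  from {x} x∈ with x ≟ r
  ... | yes x≡r = inj₂ x≡r
  ... | no x≢r = inj₁ (x∈p∧x≢y⇒x∈p-y x∈ x≢r)
...   | T₂ , to , from = T₂ , within₂ , branching₂
  where
  within₂ : Within G T₂
  within₂ e with back (from e)
  ... | inj₁ e′ = within e′
  ... | inj₂ (inj₁ (refl , refl)) = rq
  ... | inj₂ (inj₂ (refl , refl)) = N-sym G rq
  branching₂ : ∀ {x} → x ∈ S → x ∉ Z → Branching T₂ x
  branching₂ {x} x∈ x∉ with x ≟ q
  ... | no x≢q =
        let y , z , y≢z , xy , xz = branching (x∈p∧x≢y⇒x∈p-y x∈ (λ { refl → x∉ r∈Z })) (Z′⊆ x∉ x≢q)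
        in y , z , y≢z , to (keep xy) , to (keep xz)
  ... | yes refl = first (other x∉)
    where
    first : (∃ λ y → y ∈ S - r × y ≢ q) → Branching T₂ q
    first (y , y∈ , y≢q) with Tree.connected T q∈ y∈
    ... | ε = contradiction refl y≢q
    ... | e ◅ _ = _ , r , (λ { refl → x∈p-y⇒x≢y S (Tree.E-S T (Tree.E-sym T e)) refl }) ,
                  to (keep e) , to (Tree.E-sym T₁ rq′)

module _ (G : Graph n) (chordal : Chordal G) (claw-free : ClawFree G) where

  private
    Goal : Subset n → Subset n → Set
    Goal S Z = IsConnected G S → (∀ {z} → z ∈ Z → z ∈ S × Simplicial G S z) → Nonempty Z →
               Blocking G S Z → SpansBut G S Z

    connected- : ∀ {S r} → Simplicial G S r → IsConnected G S → IsConnected G (S - r)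
    connected- {S} {r} sim conn u∈ v∈ =
      detour sim (x∈p-y⇒x≢y S u∈) (x∈p-y⇒x≢y S v∈) (conn (p-x⊆p S r u∈) (p-x⊆p S r v∈))

    -- The blocking condition at a neighbour `q` of `r` leads from `r` to a mark, which is not `r`,
    -- and so gives a second neighbour `q′`. All walks to marks survive the deletion of `r`, since
    -- `r` is simplicial.
    remove-unmarked : ∀ {S Z r} → (∀ {Z} → Goal (S - r) Z) → r ∈ S → Simplicial G S r → r ∉ Z → Goal S Z
    remove-unmarked {S} {Z} {r} ih r∈ sim r∉ conn marks (z₀ , z₀∈) blocking =
      let q , rq , p = firstStep≢ (≢r z₀∈ ∘ sym) (conn r∈ (proj₁ (marks z₀∈)))
          z₁ , z₁∈ , p₁ = blocking {q} r∈ (adj⇒≢ G rq)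
          q′ , rq′ , p′ = firstStep≢ (≢r z₁∈ ∘ sym) p₁
          q′∈ = p-x-y⊆p-y-x S q r (head∈ p′)
      in reinsert G chordal claw-free r∈ sim (proj₂ ∘ marks) (head∈ p) (p-x⊆p (S - r) q q′∈)
           (x∈p-y⇒x≢y (S - r) q′∈ ∘ sym) rq rq′
           (ih (connected- sim conn) marks′ (z₀ , z₀∈) blocking′)
      where
      ≢r : ∀ {z} → z ∈ Z → z ≢ r
      ≢r z∈ refl = r∉ z∈
      marks′ : ∀ {z} → z ∈ Z → z ∈ S - r × Simplicial G (S - r) z
      marks′ z∈ = let z∈S , sim-z = marks z∈ in
        x∈p∧x≢y⇒x∈p-y z∈S (≢r z∈) , simplicial-mono {G = G} (p-x⊆p S r) sim-z
      blocking′ : Blocking G (S - r) Z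
      blocking′ {c} u∈ u≢c = let z , z∈ , p = blocking {c} (p-x⊆p S r u∈) u≢c in
        z , z∈ , mono (p-x-y⊆p-y-x S c r)
          (detour (simplicial-mono {G = G} (p-x⊆p S c) sim) (x∈p-y⇒x≢y S u∈) (≢r z∈) p)

    -- r is hung from a neighbour q as a leaf. If q becomes simplicial without r, it inherits the mark,
    -- so that q may be a leaf before r is added.
    remove-marked : ∀ {S Z r} → (∀ {Z} → Goal (S - r) Z) → (∀ {s} → s ∈ S → Simplicial G S s → s ∈ Z) →
                    r ∈ Z → Goal S Z
    remove-marked {S} {Z} {r} ih full r∈Z conn marks _ blocking with any? (λ x → x ∈? (S - r))
    ... | no empty = singleton-tree G r∈ r∈Z only
      where
      r∈ = proj₁ (marks r∈Z)
      only : ∀ {x} → x ∈ S → x ≡ r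
      only {x} x∈ = decidable-stable (x ≟ r) λ x≢r → empty (x , x∈p∧x≢y⇒x∈p-y x∈ x≢r)
    ... | yes (x₀ , x₀∈) = decide
      where
      r∈ : r ∈ S
      r∈ = proj₁ (marks r∈Z)
      sim : Simplicial G S r
      sim = proj₂ (marks r∈Z)
      full′ : ∀ {s} → s ∈ S - r → Simplicial G (S - r) s → ¬ Adj G r s → s ∈ Z - r
      full′ s∈ sim-s ¬rs =
        x∈p∧x≢y⇒x∈p-y (full (p-x⊆p S r s∈) (simplicial-add {G = G} ¬rs sim-s)) (x∈p-y⇒x≢y S s∈)
      marks′ : ∀ {z} → z ∈ Z - r → z ∈ S - r × Simplicial G (S - r) z
      marks′ z∈ = let z∈S , sim-z = marks (p-x⊆p Z r z∈) in
        x∈p∧x≢y⇒x∈p-y z∈S (x∈p-y⇒x≢y Z z∈) , simplicial-mono {G = G} (p-x⊆p S r) sim-z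
      extend : ∀ {q Z′} → q ∈ S - r → Adj G r q → (∀ {x} → x ∈ Z′ → x ∈ Z ⊎ x ≡ q) →
               SpansBut G (S - r) Z′ → SpansBut G S Z
      extend {q} q∈ rq Z′⊆ = attach-leaf G r∈ r∈Z q∈ rq other
          (λ x∉ x≢q x∈ → [ x∉ , x≢q ]′ (Z′⊆ x∈))
        where
        other : q ∉ Z → ∃ λ x → x ∈ S - r × x ≢ q
        other q∉ with any? (λ x → (x ∈? (S - r)) ×-dec ¬? (x ≟ q))
        ... | yes found = found
        ... | no none = contradiction (full (p-x⊆p S r q∈) (simplicial-dominated {G = G} close sim)) q∉
          where
          close : ∀ {a} → a ∈ S → Adj G q a → a ≡ r ⊎ Adj G r a
          close {a} a∈ qa with a ≟ r
          ... | yes a≡r = inj₁ a≡r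
          ... | no a≢r = contradiction (a , x∈p∧x≢y⇒x∈p-y a∈ a≢r , λ { refl → N-irrefl G qa }) none
      -- Every component contains a vertex `s` simplicial in `S - r`. If `s` is not adjacent to `r`,
      -- it is simplicial in `S` and hence marked, so only neighbours of `r` have to be looked at.
      blocking-by : ∀ {Z′} → Z - r ⊆ Z′ →
        (∀ {c u s} → u ≢ c → Adj G r s → Simplicial G (S - r) s → Walk G ((S - r) - c) u s →
           ∃ λ z → z ∈ Z′ × Walk G ((S - r) - c) u z) →
        Blocking G (S - r) Z′
      blocking-by {Z′} Z⊆ near {c} {u} u∈ u≢c
        with simplicial-end {G = G} chordal {S - r} {⁅ c ⁆} single-clique u∈ (x≢y⇒x∉⁅y⁆ u≢c)
        where
        single-clique : Clique G ⁅ c ⁆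
        single-clique a∈ b∈ = inj₁ (trans (x∈⁅y⁆⇒x≡y c a∈) (sym (x∈⁅y⁆⇒x≡y c b∈)))
      ... | s , _ , sim-s , p with s ∈? N G r
      ...   | yes rs = near {c} u≢c rs sim-s p
      ...   | no ¬rs = s , Z⊆ (full′ (p-x⊆p (S - r) c (last∈ p)) sim-s ¬rs) , p

      decide : SpansBut G S Z
      decide with any? (λ q → (q ∈? (S - r)) ×-dec (q ∈? N G r) ×-dec (q ∈? Z))
      -- With a marked neighbour `q`, no mark moves: a neighbour `s` of `r` simplicial in `S - r`
      -- has its closed neighbourhood inside that of `q`, so `s` is simplicial in `S` and marked
      -- already.
      ... | yes (q , q∈ , rq , q∈Z) =
            extend q∈ rq (inj₁ ∘ p-x⊆p Z r)
              (ih (connected- sim conn) marks′ (q , q∈Z-r) (blocking-by (λ x∈ → x∈) near))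
        where
        q∈Z-r : q ∈ Z - r
        q∈Z-r = x∈p∧x≢y⇒x∈p-y q∈Z (x∈p-y⇒x≢y S q∈)
        near : ∀ {c u s} → u ≢ c → Adj G r s → Simplicial G (S - r) s → Walk G ((S - r) - c) u s →
               ∃ λ z → z ∈ Z - r × Walk G ((S - r) - c) u z
        near {c} {u} {s} _ rs sim-s p with sim (p-x⊆p S r q∈) (p-x⊆p S r (p-x⊆p (S - r) c (last∈ p))) rq rs
        ... | inj₁ refl = q , q∈Z-r , p
        ... | inj₂ qs = s , x∈p∧x≢y⇒x∈p-y (full (p-x⊆p S r s∈) (simplicial-dominated {G = G} close (proj₂ (marks q∈Z)))) (x∈p-y⇒x≢y S s∈) , p
          where
          s∈ : s ∈ S - r
          s∈ = p-x⊆p (S - r) c (last∈ p)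
          close : ∀ {a} → a ∈ S → Adj G s a → a ≡ q ⊎ Adj G q a
          close {a} a∈ sa with a ≟ r
          ... | yes refl = inj₂ (N-sym G rq)
          ... | no a≢r with sim-s (x∈p∧x≢y⇒x∈p-y a∈ a≢r) q∈ sa (N-sym G qs)
          ...   | inj₁ a≡q = inj₁ a≡q
          ...   | inj₂ aq = inj₂ (N-sym G aq)
      ... | no no-mark with any? (λ q → (q ∈? (S - r)) ×-dec (q ∈? N G r) ×-dec simplicial? G (S - r) q)
      ...   | yes (q , q∈ , rq , sim-q) =
              extend {Z′ = Z₁} q∈ rq (λ x∈ → [ inj₁ ∘ p-x⊆p Z r , inj₂ ]′ (x∈p∪⁅y⁆⁻ (Z - r) q x∈))
                (ih (connected- sim conn) marks₁ (q , y∈p∪⁅y⁆ (Z - r) q) (blocking-by (p⊆p∪⁅y⁆ (Z - r) q) near))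
        where
        Z₁ : Subset n
        Z₁ = (Z - r) ∪ ⁅ q ⁆
        q∉Z : q ∉ Z
        q∉Z q∈Z = no-mark (q , q∈ , rq , q∈Z)
        marks₁ : ∀ {z} → z ∈ Z₁ → z ∈ S - r × Simplicial G (S - r) z
        marks₁ z∈ with x∈p∪⁅y⁆⁻ (Z - r) q z∈
        ... | inj₁ z∈Z = marks′ z∈Z
        ... | inj₂ refl = q∈ , sim-q
        near : ∀ {c u s} → u ≢ c → Adj G r s → Simplicial G (S - r) s → Walk G ((S - r) - c) u s →
               ∃ λ z → z ∈ Z₁ × Walk G ((S - r) - c) u z
        near {c} {u} {s} u≢c rs sim-s p with q ≟ c
        -- Neighbours of `r` are pairwise equal or adjacent, so the single new mark `q` is reached
        -- from `s`.
        ... | no q≢c with sim (p-x⊆p S r (p-x⊆p (S - r) c (last∈ p))) (p-x⊆p S r q∈) rs rq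
        ...   | inj₁ refl = q , y∈p∪⁅y⁆ (Z - r) q , p
        ...   | inj₂ sq = q , y∈p∪⁅y⁆ (Z - r) q , (p ++ edge (last∈ p) (x∈p∧x≢y⇒x∈p-y q∈ q≢c) sq)
        -- Now `q` itself is the deleted vertex. The blocking condition at `r` gives an old mark in
        -- `S - r`, and the walk to it can avoid `q`, which is simplicial there and is not that
        -- mark.
        near {c} {u} {s} u≢c rs sim-s p | yes refl =
          let u∈ = p-x⊆p (S - r) c (head∈ p)
              z , z∈ , p′ = blocking {r} (p-x⊆p S r u∈) (x∈p-y⇒x≢y S u∈)
          in z , p⊆p∪⁅y⁆ (Z - r) q (x∈p∧x≢y⇒x∈p-y z∈ (x∈p-y⇒x≢y S (last∈ p′))) ,
             detour sim-q u≢c (λ z≡q → q∉Z (subst (_∈ Z) z≡q z∈)) p′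
      -- No neighbour of `r` is simplicial in `S - r`, so all simplicial vertices found there are
      -- old marks, and `r` may hang on any neighbour.
      ...   | no no-simplicial =
              let q , rq , p = firstStep≢ (x∈p-y⇒x≢y S x₀∈ ∘ sym) (conn r∈ (p-x⊆p S r x₀∈))
              in extend (head∈ p) rq (inj₁ ∘ p-x⊆p Z r)
                   (ih (connected- sim conn) marks′ (mark (chordal (S - r) (x₀ , x₀∈)))
                     (blocking-by (λ x∈ → x∈)
                       (λ {c} _ rs sim-s p → contradiction rs (far (p-x⊆p (S - r) c (last∈ p)) sim-s))))
        where
        far : ∀ {s} → s ∈ S - r → Simplicial G (S - r) s → ¬ Adj G r s
        far s∈ sim-s rs = no-simplicial (_ , s∈ , rs , sim-s)
        mark : (∃ λ s → s ∈ S - r × Simplicial G (S - r) s) → Nonempty (Z - r)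
        mark (s , s∈ , sim-s) = s , full′ s∈ sim-s (far s∈ sim-s)

  -- Unmarked simplicial vertices are removed while there are any; otherwise the marks are all the
  -- simplicial vertices, which is what `remove-marked` asks for.
  spanning-tree : ∀ {S Z} → IsConnected G S → (∀ {z} → z ∈ Z → z ∈ S × Simplicial G S z) → Nonempty Z →
                  Blocking G S Z → SpansBut G S Z
  spanning-tree {S} {Z} = go S Z (<-wellFounded ∣ S ∣)
    where
    go : ∀ S Z → Acc _<_ ∣ S ∣ → Goal S Z
    go S Z (acc rec) conn marks (r , r∈Z) blocking
      with any? (λ s → (s ∈? S) ×-dec simplicial? G S s ×-dec ¬? (s ∈? Z))
    ... | yes (s , s∈ , sim , s∉) =
          remove-unmarked (λ {Z} → go (S - s) Z (rec (x∈p⇒∣p-x∣<∣p∣ s∈))) s∈ sim s∉ conn marks (r , r∈Z) blocking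
    ... | no none =
          remove-marked (λ {Z} → go (S - r) Z (rec (x∈p⇒∣p-x∣<∣p∣ (proj₁ (marks r∈Z))))) 
            (λ {s} s∈ sim → decidable-stable (s ∈? Z) λ s∉ → none (s , s∈ , sim , s∉)) r∈Z conn marks (r , r∈Z) blocking

-- Graphs with a non-crossing path-tree model

-- The path grows at index zero, and `start` keeps `a` away from that end.
record SimplePath (H : Graph m) (W : Subset m) (a : Fin m) (k : ℕ) : Set where
  field
    at        : Fin (2 + k) → Fin m
    injective : Injective _≡_ _≡_ at
    step      : ∀ i j → toℕ j ≡ suc (toℕ i) → Adj H (at i) (at j)
    at∈W    : ∀ i → at i ∈ W
    start     : ∃ λ i → at (suc i) ≡ a

module _ {H : Graph m} (acyclic : ¬ Cycle H) {W : Subset m} {a : Fin m} where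

  End : Set
  End = ∃ λ x → x ∈ W × x ≢ a × (∀ {y y′} → y ∈ W → y′ ∈ W → Adj H x y → Adj H x y′ → y ≡ y′)

  private
    extend : ∀ {k} → SimplePath H W a k → End ⊎ SimplePath H W a (suc k)
    extend {k} P = decide (any? λ y → (y ∈? W) ×-dec (y ∈? N H (at zero)) ×-dec ¬? (y ≟ at (suc zero)))
      where
      open SimplePath P
      decide : Dec (∃ λ y → y ∈ W × Adj H (at zero) y × y ≢ at (suc zero)) → End ⊎ SimplePath H W a (suc k)
      decide (no none) = inj₁ (at zero , at∈W zero , head≢a ,
                               λ y∈ y′∈ hy hy′ → trans (only y∈ hy) (sym (only y′∈ hy′)))
        where
        only : ∀ {y} → y ∈ W → Adj H (at zero) y → y ≡ at (suc zero)
        only {y} y∈ hy = decidable-stable (y ≟ at (suc zero)) λ y≢ → none (y , y∈ , hy , y≢)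
        head≢a : at zero ≢ a
        head≢a h≡a with injective (trans h≡a (sym (proj₂ start)))
        ... | ()
      decide (yes (y , y∈ , hy , y≢)) with any? (λ j → at j ≟ y)
      ... | yes (j , at-j) = ⊥-elim (closed j at-j)
        where
        closed : ∀ j → at j ≡ y → ⊥
        closed zero refl = N-irrefl H hy
        closed (suc zero) eq = y≢ (sym eq)
        -- The head is adjacent to the vertex at index `2 + toℕ j`, so the first `3 + toℕ j`
        -- vertices of the path form a cycle.
        closed (suc (suc j)) eq = acyclic record
          { k = toℕ j
          ; at = at ∘ ι
          ; injective = λ eq′ → inject≤-inj (injective eq′)
          ; step = λ i → step (ι (inject₁ i)) (ι (suc i))
              (trans (toℕ-inject≤ (suc i) j<) (cong suc (sym (trans (toℕ-inject≤ (inject₁ i) j<) (toℕ-inject₁ i)))))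
          ; close = subst (λ v → Adj H v (at zero))
              (trans (sym eq) (cong at (toℕ-injective (sym (trans (toℕ-inject≤ (fromℕ (2 + toℕ j)) j<) (toℕ-fromℕ (2 + toℕ j)))))))
              (N-sym H hy)
          }
          where
          j< : 3 + toℕ j ≤ 2 + k
          j< = s≤s (s≤s (toℕ<n j))
          ι : Fin (3 + toℕ j) → Fin (2 + k)
          ι i = inject≤ i j<
          inject≤-inj : ∀ {i i′} → ι i ≡ ι i′ → i ≡ i′
          inject≤-inj {i} {i′} e = toℕ-injective
            (trans (sym (toℕ-inject≤ i j<)) (trans (cong toℕ e) (toℕ-inject≤ i′ j<)))
      ... | no new = inj₂ record
        { at = at′
        ; injective = injective′
        ; step = step′
        ; at∈W = λ { zero → y∈ ; (suc i) → at∈W i }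
        ; start = suc (proj₁ start) , proj₂ start }
        where
        at′ : Fin (3 + k) → Fin m
        at′ zero = y
        at′ (suc i) = at i
        injective′ : Injective _≡_ _≡_ at′
        injective′ {zero} {zero} _ = refl
        injective′ {zero} {suc j} eq = contradiction (j , sym eq) new
        injective′ {suc i} {zero} eq = contradiction (i , eq) new
        injective′ {suc i} {suc j} eq = cong suc (injective eq)
        step′ : ∀ i j → toℕ j ≡ suc (toℕ i) → Adj H (at′ i) (at′ j)
        step′ zero (suc zero) _ = N-sym H hy
        step′ (suc i) (suc j) eq = step i j (suc-injective eq)

    -- The fuel cannot run out: at zero the bound reads `m ≤ k`, but the path has `2 + k` distinct
    -- vertices among `m`.
    grow : ∀ f {k} → m ≤ k + f → SimplePath H W a k → End
    grow zero {k} m≤ P = ⊥-elim (1+n≰n (≤-trans (≤-trans (n≤1+n _) (injective⇒≤ (SimplePath.injective P)))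
                                   (subst (m ≤_) (+-identityʳ k) m≤)))
    grow (suc f) {k} m≤ P with extend P
    ... | inj₁ end = end
    ... | inj₂ P′ = grow f (subst (m ≤_) (+-suc k f) m≤) P′

  -- A path started with the edge `ab` and extended beyond `b` must stop. That the end differs from
  -- `a` matters for leaf blocks, where `a` is the cut-vertex.
  path-end : ∀ {b} → a ∈ W → b ∈ W → Adj H a b → End
  path-end {b} a∈ b∈ ab = grow m ≤-refl record
    { at = at ; injective = injective ; step = step
    ; at∈W = λ { zero → b∈ ; (suc zero) → a∈ } ; start = zero , refl }
    where
    at : Fin 2 → Fin m
    at zero = b
    at (suc zero) = a
    injective : Injective _≡_ _≡_ at
    injective {zero} {zero} _ = refl
    injective {zero} {suc zero} refl = contradiction ab (N-irrefl H)
    injective {suc zero} {zero} refl = contradiction ab (N-irrefl H)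
    injective {suc zero} {suc zero} _ = refl
    step : ∀ i j → toℕ j ≡ suc (toℕ i) → Adj H (at i) (at j)
    step zero (suc zero) _ = N-sym H ab

acyclic-leaf : {H : Graph m} → ¬ Cycle H → ∀ {W} → Nonempty W →
               ∃ λ x → x ∈ W × (∀ {y y′} → y ∈ W → y′ ∈ W → Adj H x y → Adj H x y′ → y ≡ y′)
acyclic-leaf {H = H} acyclic {W} (x , x∈) with any? (λ y → (y ∈? W) ×-dec (y ∈? N H x))
... | yes (y , y∈ , xy) = let z , z∈ , _ , end = path-end acyclic x∈ y∈ xy in z , z∈ , end
... | no none = x , x∈ , λ y∈ _ xy _ → contradiction (_ , y∈ , xy) none

path-connected : {H : Graph m} → IsPath H → ∀ {x y} → x ∈ V H → y ∈ V H → Walk H (V H) x y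
path-connected {H = H} P x∈ y∈ = to-start x∈ ++ reverse (to-start y∈)
  where
  open IsPath P
  at∈ : ∀ i → at i ∈ V H
  at∈ i = Equivalence.from vertices (i , refl)
  go : ∀ k i → toℕ i ≡ k → Walk H (V H) (at i) (at zero)
  go zero zero _ = [ at∈ zero ]
  go (suc k) (suc i) eq = at∈ (suc i) ⟨ Equivalence.from edges (inj₂ (cong suc (sym (toℕ-inject₁ i)))) ⟩
                          go k (inject₁ i) (trans (toℕ-inject₁ i) (suc-injective eq))
  to-start : ∀ {x} → x ∈ V H → Walk H (V H) x (at zero)
  to-start x∈ with Equivalence.to vertices x∈
  ... | i , refl = go (toℕ i) i refl

module _ {G : Graph n} {P : Fin n → Graph m} {T : Graph m} (model : PathTreeModel G P T) where

  open PathTreeModel model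

  private
    Meet : Fin n → Fin n → Fin m → Set
    Meet u v x = x ∈ V (P u) × x ∈ V (P v)

    adj⇒meet : ∀ {u v} → Adj G u v → ∃ (Meet u v)
    adj⇒meet uv = Equivalence.to (intersect (N⊆V G (N-sym G uv)) (N⊆V G uv) (adj⇒≢ G uv)) uv

    Adj-T : ∀ {v x y} → v ∈ V G → Adj (P v) x y → Adj T x y
    Adj-T v∈ xy = Equivalence.from tree-E (_ , v∈ , xy)

  model-chordal : Chordal G
  model-chordal S (v₀ , v₀∈) with any? (λ v → (v ∈? S) ×-dec ¬? (v ∈? V G))
  -- A member of `S` outside `G` has no neighbours, so it is simplicial.
  ... | yes (v , v∈ , v∉) = v , v∈ , λ _ _ va _ → contradiction (N⊆V G (N-sym G va)) v∉
  ... | no all-in = go ⊤ (<-wellFounded ∣ ⊤ {m} ∣)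
          (λ v∈ x∈ y∈ → mono (λ _ → ∈⊤) (path-connected (paths (S⊆V v∈)) (proj₂ x∈) (proj₂ y∈)))
          share
    where
    S⊆V : ∀ {v} → v ∈ S → v ∈ V G
    S⊆V {v} v∈ = decidable-stable (v ∈? V G) λ v∉ → all-in (v , v∈ , v∉)
    share : ∀ {u v} → u ∈ S → v ∈ S → u ≡ v ⊎ Adj G u v → ∃ λ x → x ∈ ⊤ × Meet u v x
    share u∈ _ (inj₁ refl) = let open IsPath (paths (S⊆V u∈)) ; x∈ = Equivalence.from vertices (zero , refl) in
      at zero , ∈⊤ , x∈ , x∈
    share _ _ (inj₂ uv) = let x , meet = adj⇒meet uv in x , ∈⊤ , meet
    -- The host tree is pruned leaf by leaf, down to a leaf x that is all that is left of some path.
    go : ∀ W → Acc _<_ ∣ W ∣ →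
         (∀ {v x y} → v ∈ S → x ∈ W × x ∈ V (P v) → y ∈ W × y ∈ V (P v) → Walk (P v) W x y) →
         (∀ {u v} → u ∈ S → v ∈ S → u ≡ v ⊎ Adj G u v → ∃ λ x → x ∈ W × Meet u v x) →
         ∃ λ r → r ∈ S × Simplicial G S r
    go W (acc rec) conn share
      with acyclic-leaf (proj₂ tree) {W} (let x , x∈ , _ = share v₀∈ v₀∈ (inj₁ refl) in x , x∈)
    ... | x , x∈ , leaf
      with any? (λ v → (v ∈? S) ×-dec all? (λ y → (y ∈? W) →-dec (y ∈? V (P v)) →-dec (y ≟ x)))
    ...   | yes (v , v∈ , only) = v , v∈ , simplicial
      where
      at-x : ∀ {a} → a ∈ S → Adj G v a → x ∈ V (P a)
      at-x {a} a∈ va = let y , y∈ , y∈v , y∈a = share v∈ a∈ (inj₂ va) in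
        subst (_∈ V (P a)) (only y y∈ y∈v) y∈a
      simplicial : Simplicial G S v
      simplicial {a} {b} a∈ b∈ va vb with a ≟ b
      ... | yes a≡b = inj₁ a≡b
      ... | no a≢b = inj₂ (Equivalence.from (intersect (S⊆V a∈) (S⊆V b∈) a≢b) (x , at-x a∈ va , at-x b∈ vb))
    ...   | no none = go (W - x) (rec (x∈p⇒∣p-x∣<∣p∣ x∈)) conn′ share′
      where
      -- A leaf has at most one neighbour and is trivially simplicial, so `detour` also prunes
      -- paths.
      leaf-P : ∀ {v} → v ∈ S → Simplicial (P v) W x
      leaf-P v∈ a∈ b∈ xa xb = inj₁ (leaf a∈ b∈ (Adj-T (S⊆V v∈) xa) (Adj-T (S⊆V v∈) xb))
      conn′ : ∀ {v y z} → v ∈ S → y ∈ W - x × y ∈ V (P v) → z ∈ W - x × z ∈ V (P v) → Walk (P v) (W - x) y z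
      conn′ v∈ (y∈ , y∈v) (z∈ , z∈v) =
        detour (leaf-P v∈) (x∈p-y⇒x≢y W y∈) (x∈p-y⇒x≢y W z∈)
          (conn v∈ (p-x⊆p W x y∈ , y∈v) (p-x⊆p W x z∈ , z∈v))
      other : ∀ {v} → v ∈ S → ∃ λ y → y ∈ W × y ∈ V (P v) × y ≢ x
      other {v} v∈ with any? (λ y → (y ∈? W) ×-dec (y ∈? V (P v)) ×-dec ¬? (y ≟ x))
      ... | yes found = found
      ... | no ¬found = contradiction
              (v , v∈ , λ y y∈ y∈v → decidable-stable (y ≟ x) λ y≢x → ¬found (y , y∈ , y∈v , y≢x)) none
      neighbour : ∀ {v} → v ∈ S → x ∈ V (P v) → ∃ λ w → w ∈ W - x × w ∈ V (P v) × Adj T x w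
      neighbour {v} v∈ x∈v =
        let y , y∈ , y∈v , y≢x = other v∈
            w , xw , p = firstStep≢ (y≢x ∘ sym) (conn v∈ (x∈ , x∈v) (y∈ , y∈v))
        in w , head∈ p , N⊆V (P v) xw , Adj-T (S⊆V v∈) xw
      share′ : ∀ {u v} → u ∈ S → v ∈ S → u ≡ v ⊎ Adj G u v → ∃ λ y → y ∈ W - x × Meet u v y
      share′ {u} {v} u∈ v∈ uv with share u∈ v∈ uv
      ... | y , y∈ , y∈u , y∈v with y ≟ x
      ...   | no y≢x = y , x∈p∧x≢y⇒x∈p-y y∈ y≢x , y∈u , y∈v
      -- Both paths reach beyond the leaf `x`, and can do so only through its one neighbour, where
      -- they still meet.
      ...   | yes refl =
              let w , w∈ , w∈u , xw = neighbour u∈ y∈u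
                  w′ , w′∈ , w′∈v , xw′ = neighbour v∈ y∈v
              in w , w∈ , w∈u , subst (_∈ V (P v)) (sym (leaf (p-x⊆p W x w∈) (p-x⊆p W x w′∈) xw xw′)) w′∈v

  -- Of three disjoint paths meeting P x, the middle one would disconnect P x.
  model-claw-free : (∀ {u v} → u ∈ V G → v ∈ V G → u ≢ v → NonCrossing (P u) (P v)) → ClawFree G
  model-claw-free non-crossing {x} {a} {b} {c} xa xb xc a≢b a≢c b≢c
    with b ∈? N G a | c ∈? N G a | c ∈? N G b
  ... | yes ab | _ | _ = inj₁ ab
  ... | no _ | yes ac | _ = inj₂ (inj₁ ac)
  ... | no _ | no _ | yes bc = inj₂ (inj₂ bc)
  ... | no ¬ab | no ¬ac | no ¬bc = ⊥-elim (order (index xa) (index xb) (index xc))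
    where
    x∈ : x ∈ V G
    x∈ = N⊆V G (N-sym G xa)
    open IsPath (paths x∈)
    Index : Fin n → Set
    Index y = ∃ λ i → at i ∈ V (P y)
    index : ∀ {y} → Adj G x y → Index y
    index xy with adj⇒meet xy
    ... | z , z∈x , z∈y with Equivalence.to vertices z∈x
    ...   | i , refl = i , z∈y
    Apart : Fin n → Fin n → Set
    Apart y z = ∀ {w} → w ∈ V (P y) → w ∉ V (P z)
    apart : ∀ {y z} → Adj G x y → Adj G x z → y ≢ z → ¬ Adj G y z → Apart y z
    apart xy xz y≢z ¬yz w∈y w∈z =
      ¬yz (Equivalence.from (intersect (N⊆V G xy) (N⊆V G xz) y≢z) (_ , w∈y , w∈z))
    -- Each step along `P x` changes the index by one, so a walk from below `j` to above `j` would
    -- have to visit `j`, which is deleted with `P y`.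
    middle : ∀ {y i j k} → Adj G x y → at j ∈ V (P y) → at i ∉ V (P y) → at k ∉ V (P y) →
             toℕ i < toℕ j → toℕ j < toℕ k → ⊥
    middle {y} {i} {j} {k} xy j∈ i∉ k∉ i<j j<k = <-asym j<k (before (cut (at∈ i i∉) (at∈ k k∉)) i refl i<j)
      where
      cut : Connected (P x ∖ V (P y))
      cut = proj₁ (non-crossing x∈ (N⊆V G xy) (adj⇒≢ G xy))
      at∈ : ∀ i → at i ∉ V (P y) → at i ∈ V (P x ∖ V (P y))
      at∈ i i∉ = x∈p∩q⁺ (Equivalence.from vertices (i , refl) , x∉p⇒x∈∁p i∉)
      before : ∀ {u} → Star (Adj (P x ∖ V (P y))) u (at k) → ∀ i → at i ≡ u → toℕ i < toℕ j → toℕ k < toℕ j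
      before ε i eq i<j with injective eq
      ... | refl = i<j
      before (s ◅ ss) i refl i<j
        with inducedN⁻ (P x) (∁ (V (P y))) s
      ... | s′ , _ , v∈ with Equivalence.to vertices (N⊆V (P x) s′)
      ...   | i′ , refl with Equivalence.to edges s′
      ...     | inj₁ eq = before ss i′ refl (≤∧≢⇒< (subst (_≤ toℕ j) (sym eq) i<j)
                            (λ i′≡j → x∈∁p⇒x∉p v∈ (subst (λ h → at h ∈ V (P y)) (sym (toℕ-injective i′≡j)) j∈)))
      ...     | inj₂ eq = before ss i′ refl (≤-trans (n≤1+n _) (subst (_< toℕ j) eq i<j))
    ab-apart = apart xa xb a≢b ¬ab
    ac-apart = apart xa xc a≢c ¬ac
    bc-apart = apart xb xc b≢c ¬bc
    same : ∀ {y z} → Apart y z → (i : Index y) (j : Index z) → toℕ (proj₁ i) ≢ toℕ (proj₁ j)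
    same ap (i , i∈) (j , j∈) eq with toℕ-injective eq
    ... | refl = ap i∈ j∈
    order : Index a → Index b → Index c → ⊥
    order ia@(i , i∈) ib@(j , j∈) ic@(k , k∈)
      with <-cmp (toℕ i) (toℕ j) | <-cmp (toℕ j) (toℕ k) | <-cmp (toℕ i) (toℕ k)
    ... | tri≈ _ eq _ | _ | _ = same ab-apart ia ib eq
    ... | _ | tri≈ _ eq _ | _ = same bc-apart ib ic eq
    ... | _ | _ | tri≈ _ eq _ = same ac-apart ia ic eq
    ... | tri< i<j _ _ | tri< j<k _ _ | _ = middle xb j∈ (ab-apart i∈) (λ k∈b → bc-apart k∈b k∈) i<j j<k
    ... | tri> _ _ j<i | tri> _ _ k<j | _ = middle xb j∈ (λ k∈b → bc-apart k∈b k∈) (ab-apart i∈) k<j j<i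
    ... | tri< i<j _ _ | tri> _ _ k<j | tri< i<k _ _ = middle xc k∈ (ac-apart i∈) (bc-apart j∈) i<k k<j
    ... | tri> _ _ j<i | tri< j<k _ _ | tri> _ _ k<i = middle xc k∈ (bc-apart j∈) (ac-apart i∈) j<k k<i
    ... | tri< i<j _ _ | tri> _ _ k<j | tri> _ _ k<i = middle xa i∈ (λ k∈a → ac-apart k∈a k∈) (λ j∈a → ab-apart j∈a j∈) k<i i<j
    ... | tri> _ _ j<i | tri< j<k _ _ | tri< i<k _ _ = middle xa i∈ (λ j∈a → ab-apart j∈a j∈) (λ k∈a → ac-apart k∈a k∈) j<i i<k

-- From parent pointers to spanning trees of type Graph

argmax : ∀ {k} (f : Fin (suc k) → ℕ) → ∃ λ i → ∀ j → f j ≤ f i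
argmax {zero} f = zero , λ { zero → ≤-refl }
argmax {suc k} f with argmax (f ∘ suc)
... | i , max with ≤-total (f zero) (f (suc i))
...   | inj₁ f0≤ = suc i , λ { zero → f0≤ ; (suc j) → max j }
...   | inj₂ ≤f0 = zero , λ { zero → ≤-refl ; (suc j) → ≤-trans (max j) ≤f0 }

module _ {H : Graph n} (C : Cycle H) where

  open Cycle C

  cycle-neighbours : ∀ i → ∃ λ j → ∃ λ j′ → j ≢ j′ × Adj H (at i) (at j) × Adj H (at i) (at j′)
  cycle-neighbours zero = suc zero , fromℕ (2 + k) , (λ ()) , step zero , N-sym H close
  cycle-neighbours (suc i) with next (suc i) (view (suc i))
    where
    next : ∀ i → View i → ∃ λ j → Adj H (at i) (at j) × (toℕ j ≡ suc (toℕ i) ⊎ (j ≡ zero × toℕ i ≡ suc (suc k)))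
    next _ ‵fromℕ = zero , close , inj₂ (refl , toℕ-fromℕ _)
    next _ (‵inject₁ j) = suc j , step j , inj₁ (cong suc (sym (toℕ-inject₁ j)))
  ... | j , adj , which = inject₁ i , j , distinct which , N-sym H (step i) , adj
    where
    distinct : (toℕ j ≡ suc (suc (toℕ i)) ⊎ (j ≡ zero × suc (toℕ i) ≡ suc (suc k))) → inject₁ i ≢ j
    distinct (inj₁ eq) refl = m≢2+m (trans (sym (toℕ-inject₁ i)) eq)
      where
      m≢2+m : ∀ {m} → m ≢ suc (suc m)
      m≢2+m ()
    distinct (inj₂ (refl , eq)) eq′ with trans (sym (toℕ-inject₁ i)) (cong toℕ eq′)
    ... | i≡0 with trans (sym (cong suc i≡0)) eq
    ...   | ()

∣p∣≡1⇒unique : ∀ {p : Subset n} {x y} → ∣ p ∣ ≡ 1 → x ∈ p → y ∈ p → x ≡ y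
∣p∣≡1⇒unique {p = p} {x} {y} eq x∈ y∈ = decidable-stable (x ≟ y) λ x≢y →
  1+n≰n (≤-trans (s≤s (s≤s z≤n)) (≤-trans (s≤s (x∈p⇒∣p-x∣<∣p∣ (x∈p∧x≢y⇒x∈p-y y∈ (x≢y ∘ sym))))
    (subst (∣ p - x ∣ <_) eq (x∈p⇒∣p-x∣<∣p∣ x∈))))

∣p∣≡1⇒nonempty : ∀ {p : Subset n} → ∣ p ∣ ≡ 1 → Nonempty p
∣p∣≡1⇒nonempty {n} {p} eq with nonempty? p
... | yes found = found
... | no empty with trans (sym eq) (trans (cong ∣_∣ (Empty-unique empty)) (∣⊥∣≡0 n))
...   | ()

∈-leaves⁻ : (T : Graph n) → ∀ {x} → x ∈ leaves T → ∣ N T x ∣ ≡ 1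
∈-leaves⁻ T = ∈-⟪⟫⁻ (λ v → ∣ N T v ∣ ℕ.≟ 1)

∈-leaves⁺ : (T : Graph n) → ∀ {x} → ∣ N T x ∣ ≡ 1 → x ∈ leaves T
∈-leaves⁺ T = ∈-⟪⟫⁺ (λ v → ∣ N T v ∣ ℕ.≟ 1)

module _ (G : Graph n) (T : Tree (_∈ V G)) (within : Within G T) where

  open Tree T using (root; parent; E-S; E-sym; E-irrefl; depth; child-depth; connected)

  private
    Child? : ∀ a b → Dec (Tree.Child T a b)
    Child? a b = (a ∈? V G) ×-dec ¬? (a ≟ root) ×-dec (parent a ≟ b)

    E? : ∀ a b → Dec (E T a b)
    E? a b = Child? a b ⊎-dec Child? b a

  tree-graph : Graph n
  tree-graph = record
    { V = V G
    ; N = λ x → ⟪ E? x ⟫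
    ; N⊆V = λ {u} y∈ → E-S (E-sym (∈-⟪⟫⁻ (E? u) y∈))
    ; N-sym = λ {u} {v} v∈ → ∈-⟪⟫⁺ (E? v) (E-sym (∈-⟪⟫⁻ (E? u) v∈))
    ; N-irrefl = λ {u} u∈ → E-irrefl (∈-⟪⟫⁻ (E? u) u∈)
    }

  private
    adj⁻ : ∀ {x y} → Adj tree-graph x y → E T x y
    adj⁻ {x} = ∈-⟪⟫⁻ (E? x)

    adj⁺ : ∀ {x y} → E T x y → Adj tree-graph x y
    adj⁺ {x} = ∈-⟪⟫⁺ (E? x)

  -- Both neighbours of a deepest vertex of a cycle would be its parent.
  tree-graph-acyclic : ¬ Cycle tree-graph
  tree-graph-acyclic C = let i , max = argmax (λ i → depth (at∈ i)) in deepest i max (cycle-neighbours C i)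
    where
    open Cycle C
    at∈ : ∀ i → at i ∈ V G
    at∈ i = let _ , _ , _ , a , _ = cycle-neighbours C i in E-S (adj⁻ a)
    deepest : ∀ i → (∀ j → depth (at∈ j) ≤ depth (at∈ i)) →
              ¬ (∃ λ j → ∃ λ j′ → j ≢ j′ × Adj tree-graph (at i) (at j) × Adj tree-graph (at i) (at j′))
    deepest i max (j , j′ , j≢j′ , a , a′) =
      j≢j′ (injective (trans (sym (is-parent (adj⁻ a))) (is-parent (adj⁻ a′))))
      where
      is-parent : ∀ {j} → E T (at i) (at j) → parent (at i) ≡ at j
      is-parent (inj₁ (_ , _ , eq)) = eq
      is-parent {j} (inj₂ c) =
        contradiction (subst (_≤ depth (at∈ i)) (child-depth c (at∈ j) (at∈ i)) (max j)) 1+n≰n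

  tree-graph-spanning : SpanningTree G tree-graph
  tree-graph-spanning = record
    { subgraph = record { V-⊆ = λ x∈ → x∈ ; N-⊆ = λ y∈ → within (adj⁻ y∈) }
    ; spanning = refl
    ; tree = (λ x∈ y∈ → Star.map adj⁺ (connected x∈ y∈)) , tree-graph-acyclic
    }

  tree-graph-leaf : ∀ {x} → x ∈ leaves tree-graph → x ∈ V G × ¬ Branching T x
  tree-graph-leaf {x} x∈ = E-S (adj⁻ (proj₂ (∣p∣≡1⇒nonempty {p = ⟪ E? x ⟫} one))) ,
    λ (y , z , y≢z , xy , xz) → y≢z (∣p∣≡1⇒unique one (adj⁺ xy) (adj⁺ xz))
    where
    one : ∣ N tree-graph x ∣ ≡ 1
    one = ∈-leaves⁻ tree-graph x∈

spanning-graph : (G : Graph n) → ∀ {Z} → SpansBut G (V G) Z → ∃ λ T → SpanningTree G T × leaves T ⊆ Z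
spanning-graph G {Z} (T , within , branching) =
  tree-graph G T within , tree-graph-spanning G T within , λ {x} x∈ →
    let x∈V , ¬b = tree-graph-leaf G T within x∈ in
    decidable-stable (x ∈? Z) λ x∉ → ¬b (branching x∈V x∉)

-- Marks and end blocks

-- A positive and decidable form of `CutVertex`, with the two separated vertices as witnesses.
Cut : Graph n → Fin n → Set
Cut G c = c ∈ V G × ∃ λ u → ∃ λ v → u ∈ V G - c × v ∈ V G - c × ¬ Walk G (V G - c) u v

module _ {G : Graph n} where

  nest : ∀ {S S′ R u v} → S′ ⊆ S → S′ ⊆ R → Walk G S′ u v → Walk (induced G S) R u v
  nest S⊆ R⊆ [ u∈ ] = [ R⊆ u∈ ]
  nest {S} S⊆ R⊆ (u∈ ⟨ a ⟩ p) = R⊆ u∈ ⟨ inducedN⁺ G S a (S⊆ u∈) (S⊆ (head∈ p)) ⟩ nest S⊆ R⊆ p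

  from-star : ∀ {u v} → u ∈ V G → Star (Adj G) u v → Walk G (V G) u v
  from-star u∈ ε = [ u∈ ]
  from-star u∈ (a ◅ p) = u∈ ⟨ a ⟩ from-star (N⊆V G a) p

  sub-walk : ∀ {H S u v} → G ⊑ H → Walk G S u v → Walk H S u v
  sub-walk G⊑ [ u∈ ] = [ u∈ ]
  sub-walk G⊑ (u∈ ⟨ a ⟩ p) = u∈ ⟨ N-⊆ G⊑ a ⟩ sub-walk G⊑ p

connected⇒walk : (G : Graph n) → Connected G → IsConnected G (V G)
connected⇒walk G conn u∈ v∈ = from-star u∈ (conn u∈ v∈)

∖-V : (G : Graph n) → ∀ {c x} → x ∈ V G - c → x ∈ V (G ∖ ⁅ c ⁆)
∖-V G {c} x∈ = x∈p∩q⁺ (p-x⊆p (V G) c x∈ , x∉p⇒x∈∁p (x≢y⇒x∉⁅y⁆ (x∈p-y⇒x≢y (V G) x∈)))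

∖-V⁻ : (G : Graph n) → ∀ {c x} → x ∈ V (G ∖ ⁅ c ⁆) → x ∈ V G - c
∖-V⁻ G {c} x∈ = let x∈V , x∈∁ = x∈p∩q⁻ (V G) (∁ ⁅ c ⁆) x∈ in
  x∈p∧x≢y⇒x∈p-y x∈V (x∉⁅y⁆⇒x≢y (x∈∁p⇒x∉p x∈∁))

connected-∖⇒walk : (G : Graph n) → ∀ {c} → Connected (G ∖ ⁅ c ⁆) → IsConnected G (V G - c)
connected-∖⇒walk G {c} conn u∈ v∈ =
  stay-in (λ x∈ y∈ a → x∈p∧x≢y⇒x∈p-y (N⊆V G a) (x∉⁅y⁆⇒x≢y (x∈∁p⇒x∉p y∈))) u∈
    (fromStar (proj₂ (x∈p∩q⁻ (V G) (∁ ⁅ c ⁆) (∖-V G u∈))) (conn (∖-V G u∈) (∖-V G v∈)))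

walk⇒connected-∖ : (G : Graph n) → ∀ {c} → IsConnected G (V G - c) → Connected (G ∖ ⁅ c ⁆)
walk⇒connected-∖ G {c} conn u∈ v∈ =
  toStar (mono (λ x∈ → proj₂ (x∈p∩q⁻ (V G) (∁ ⁅ c ⁆) (∖-V G x∈))) (conn (∖-V⁻ G u∈) (∖-V⁻ G v∈)))

cut? : (G : Graph n) → ∀ c → Dec (Cut G c)
cut? G c = (c ∈? V G) ×-dec any? λ u → any? λ v →
  (u ∈? (V G - c)) ×-dec (v ∈? (V G - c)) ×-dec ¬? (walk? G (V G - c) u v)

¬cut⇒connected : (G : Graph n) → ∀ {c} → c ∈ V G → ¬ Cut G c → IsConnected G (V G - c)
¬cut⇒connected G {c} c∈ ¬cut u∈ v∈ =
  decidable-stable (walk? G (V G - c) _ _) λ ¬p → ¬cut (c∈ , _ , _ , u∈ , v∈ , ¬p)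

cut⇒CutVertex : (G : Graph n) → ∀ {c} → Cut G c → CutVertex G c
cut⇒CutVertex G (c∈ , _ , _ , u∈ , v∈ , ¬p) = c∈ , λ conn → ¬p (connected-∖⇒walk G conn u∈ v∈)

CutVertex⇒cut : (G : Graph n) → ∀ {c} → CutVertex G c → Cut G c
CutVertex⇒cut G {c} (c∈ , ¬conn) = decidable-stable (cut? G c) λ ¬cut →
  ¬conn (walk⇒connected-∖ G (¬cut⇒connected G c∈ ¬cut))

-- `TwoConnected` merely denies cut-vertices, so a given 2-connected graph returns connectedness up
-- to double negation; the hypothesis is weakened to match.
induced-twoConnected : (G : Graph n) → ∀ S → IsConnected G S →
                       (∀ {z} → z ∈ S → ¬ ¬ IsConnected G (S - z)) → TwoConnected (induced G S)
induced-twoConnected G S conn conn- =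
  (λ u∈ v∈ → toStar (conn (V⊆S u∈) (V⊆S v∈))) ,
  λ z (z∈ , ¬conn) → conn- (V⊆S z∈) λ c → ¬conn (walk⇒connected-∖ (induced G S) λ u∈ v∈ →
    stay-in (λ x∈ y∈ a → x∈p∧x≢y⇒x∈p-y (N⊆V (induced G S) a) (x∈p-y⇒x≢y S y∈)) u∈
      (nest (p-x⊆p S z) (λ x∈ → x∈) (c (shrink u∈) (shrink v∈))))
  where
  V⊆S : V (induced G S) ⊆ S
  V⊆S x∈ = proj₂ (x∈p∩q⁻ (V G) S x∈)
  shrink : ∀ {z x} → x ∈ V (induced G S) - z → x ∈ S - z
  shrink {z} x∈ = x∈p∧x≢y⇒x∈p-y (V⊆S (p-x⊆p (V (induced G S)) z x∈)) (x∈p-y⇒x≢y (V (induced G S)) x∈)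

twoConnected⇒walk : (C : Graph n) → TwoConnected C → ∀ {z} → z ∈ V C → ¬ ¬ IsConnected C (V C - z)
twoConnected⇒walk C (_ , no-cut) {z} z∈ ¬conn = no-cut z (z∈ , λ conn → ¬conn (connected-∖⇒walk C conn))

module _ (G : Graph n) (connected : Connected G) (chordal : Chordal G) where

  private
    conn : IsConnected G (V G)
    conn = connected⇒walk G connected

  simplicial⇒¬cut : ∀ {l} → Simplicial G (V G) l → ¬ Cut G l
  simplicial⇒¬cut {l} sim (_ , u , v , u∈ , v∈ , ¬p) =
    ¬p (detour sim (x∈p-y⇒x≢y (V G) u∈) (x∈p-y⇒x≢y (V G) v∈) (conn (p-x⊆p (V G) l u∈) (p-x⊆p (V G) l v∈)))

  -- The restriction to cut-vertices makes minimality of `Z` attach a cut-vertex to every mark.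
  CutBlocking : Subset n → Set
  CutBlocking Z = ∀ c u → Cut G c → u ∈ V G - c → ∃ λ z → z ∈ Z × Walk G (V G - c) u z

  cutBlocking? : ∀ Z → Dec (CutBlocking Z)
  cutBlocking? Z = all? λ c → all? λ u → cut? G c →-dec (u ∈? (V G - c)) →-dec
    any? λ z → (z ∈? Z) ×-dec walk? G (V G - c) u z

  Simplicials : Subset n → Set
  Simplicials Z = ∀ {z} → z ∈ Z → z ∈ V G × Simplicial G (V G) z

  Alone : Subset n → Fin n → Fin n → Set
  Alone Z c l = Cut G c × l ∈ V G - c × (∀ {z} → z ∈ Z → Walk G (V G - c) l z → z ≡ l)

  -- All simplicial vertices form a start, and marks are dropped while the condition holds. If
  -- dropping `l` would violate it for some `c` and `u`, then `l` is the only mark in the component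
  -- of `u` in `G - c`.
  minimal-blocking : ∃ λ Z → Simplicials Z × CutBlocking Z × (∀ {l} → l ∈ Z → ∃ λ c → Alone Z c l)
  minimal-blocking = go Z₀ (<-wellFounded ∣ Z₀ ∣) (∈-⟪⟫⁻ P?) blocking₀
    where
    P? : ∀ x → Dec (x ∈ V G × Simplicial G (V G) x)
    P? x = (x ∈? V G) ×-dec simplicial? G (V G) x
    Z₀ : Subset n
    Z₀ = ⟪ P? ⟫
    blocking₀ : CutBlocking Z₀
    blocking₀ c u _ u∈ =
      let s , _ , sim , p = simplicial-end {G = G} chordal {V G} {⁅ c ⁆}
            (λ a∈ b∈ → inj₁ (trans (x∈⁅y⁆⇒x≡y c a∈) (sym (x∈⁅y⁆⇒x≡y c b∈))))
            (p-x⊆p (V G) c u∈) (x≢y⇒x∉⁅y⁆ (x∈p-y⇒x≢y (V G) u∈))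
      in s , ∈-⟪⟫⁺ P? (p-x⊆p (V G) c (last∈ p) , sim) , p
    alone : ∀ {Z l} → CutBlocking Z → ¬ CutBlocking (Z - l) → ∃ λ c → Alone Z c l
    alone {Z} {l} blocking ¬blocking = decidable-stable (any? λ c → cut? G c ×-dec (l ∈? (V G - c)) ×-dec
        map′ (λ f {z} → f z) (λ f z → f {z}) (all? λ z → (z ∈? Z) →-dec walk? G (V G - c) l z →-dec (z ≟ l)))
      λ none → ¬blocking λ c u cut u∈ →
        decidable-stable (any? λ z → (z ∈? (Z - l)) ×-dec walk? G (V G - c) u z) λ unreached →
          let z , z∈ , p = blocking c u cut u∈
              reached : ∀ {z} → z ∈ Z → Walk G (V G - c) u z → z ≡ l
              reached {z} z∈ p = decidable-stable (z ≟ l) λ z≢l → unreached (z , x∈p∧x≢y⇒x∈p-y z∈ z≢l , p)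
              u⇝l = subst (Walk G (V G - c) u) (reached z∈ p) p
          in none (c , cut , last∈ u⇝l , λ z′∈ q → reached z′∈ (u⇝l ++ q))
    go : ∀ Z → Acc _<_ ∣ Z ∣ → Simplicials Z → CutBlocking Z →
         ∃ λ Z → Simplicials Z × CutBlocking Z × (∀ {l} → l ∈ Z → ∃ λ c → Alone Z c l)
    go Z (acc rec) sims blocking with any? (λ l → (l ∈? Z) ×-dec cutBlocking? (Z - l))
    ... | yes (l , l∈ , blocking′) =
          go (Z - l) (rec (x∈p⇒∣p-x∣<∣p∣ l∈)) (λ z∈ → sims (p-x⊆p Z l z∈)) blocking′
    ... | no none = Z , sims , blocking , λ {l} l∈ → alone blocking λ b → none (l , l∈ , b)

  module _ {Z : Subset n} (sims : Simplicials Z) (blocking : CutBlocking Z) where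

    -- The cut-vertex `v` separates two marks, so for any `c` some mark differs from `c`; it is
    -- reached in `G - c` whenever `c` does not cut.
    cutBlocking⇒blocking : (∃ λ v → Cut G v) → Nonempty Z × Blocking G (V G) Z
    cutBlocking⇒blocking (v , cut-v@(_ , a , b , a∈ , b∈ , ¬ab)) = (proj₁ za , proj₁ (proj₂ za)) , result
      where
      za = blocking v a cut-v a∈
      zb = blocking v b cut-v b∈
      another : ∀ c → ∃ λ z → z ∈ Z × z ≢ c
      another c = choose za zb
        where
        choose : (∃ λ z → z ∈ Z × Walk G (V G - v) a z) → (∃ λ z → z ∈ Z × Walk G (V G - v) b z) →
                 ∃ λ z → z ∈ Z × z ≢ c
        choose (x , x∈ , p) (y , y∈ , q) with x ≟ c
        ... | no x≢c = x , x∈ , x≢c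
        ... | yes refl = y , y∈ , λ { refl → ¬ab (p ++ reverse q) }
      result : Blocking G (V G) Z
      result {c} {u} u∈ u≢c with cut? G c | c ∈? V G
      ... | yes cut-c | _ = blocking c u cut-c (x∈p∧x≢y⇒x∈p-y u∈ u≢c)
      ... | no ¬cut | yes c∈ = let z , z∈ , z≢c = another c in
            z , z∈ , ¬cut⇒connected G c∈ ¬cut (x∈p∧x≢y⇒x∈p-y u∈ u≢c) (x∈p∧x≢y⇒x∈p-y (proj₁ (sims z∈)) z≢c)
      ... | no _ | no c∉ = let z , z∈ , _ = another c in
            z , z∈ , mono (λ x∈ → x∈p∧x≢y⇒x∈p-y x∈ λ { refl → c∉ x∈ }) (conn u∈ (proj₁ (sims z∈)))

    -- If the component of `x` in `G - d` misses `c`, its walks also live in `G - c`. This compares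
    -- components for different deleted vertices.
    avoid : ∀ {c d x y} → ¬ Walk G (V G - d) x c → Walk G (V G - d) x y → Walk G (V G - c) x y
    avoid {d = d} ¬c [ x∈ ] = [ x∈p∧x≢y⇒x∈p-y (p-x⊆p (V G) d x∈) (λ { refl → ¬c [ x∈ ] }) ]
    avoid {d = d} ¬c (x∈ ⟨ a ⟩ p) =
      x∈p∧x≢y⇒x∈p-y (p-x⊆p (V G) d x∈) (λ { refl → ¬c [ x∈ ] }) ⟨ a ⟩ avoid (λ q → ¬c (x∈ ⟨ a ⟩ q)) p

    Component : Fin n → Fin n → Subset n
    Component c l = ⟪ walk? G (V G - c) l ⟫

    -- Some x is separated from c by d; the mark in its component of G - d is also connected to l in
    -- G - c, hence equals l.
    shrink-component : ∀ {c d l} → Alone Z c l → Walk G (V G - c) l d → Cut G d →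
                       Alone Z d l × ∣ Component d l ∣ < ∣ Component c l ∣
    shrink-component {c} {d} {l} (_ , l∈ , alone) l⇝d cut-d@(d∈ , a , b , a∈ , b∈ , ¬ab) = result side
      where
      side : ∃ λ x → x ∈ V G - d × ¬ Walk G (V G - d) x c
      side with walk? G (V G - d) a c
      ... | no ¬ac = a , a∈ , ¬ac
      ... | yes ac = b , b∈ , λ bc → ¬ab (ac ++ reverse bc)
      result : (∃ λ x → x ∈ V G - d × ¬ Walk G (V G - d) x c) → Alone Z d l × ∣ Component d l ∣ < ∣ Component c l ∣
      result (x , x∈ , ¬xc) =
        (cut-d , last∈ x⇝l , λ z∈ p → alone z∈ (l⇝x ++ avoid ¬xc (x⇝l ++ p))) ,
        p⊂q⇒∣p∣<∣q∣ ( (λ y∈ → ∈-⟪⟫⁺ (walk? G (V G - c) l)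
                              (l⇝x ++ avoid ¬xc (x⇝l ++ ∈-⟪⟫⁻ (walk? G (V G - d) l) y∈)))
                    , d , ∈-⟪⟫⁺ (walk? G (V G - c) l) l⇝d
                    , λ d∈ → x∈p-y⇒x≢y (V G) (last∈ (∈-⟪⟫⁻ (walk? G (V G - d) l) d∈)) refl)
        where
        x≢d : x ≢ d
        x≢d = x∈p-y⇒x≢y (V G) x∈
        reach-d : ∃ λ w → Walk G (V G - d) x w × Adj G w d
        reach-d = until d x≢d (conn (p-x⊆p (V G) d x∈) d∈) x∈p∧x≢y⇒x∈p-y
        l⇝x : Walk G (V G - c) l x
        l⇝x = let w , p , wd = reach-d
                  q = avoid ¬xc p
              in l⇝d ++ reverse (q ++ edge (last∈ q) (last∈ l⇝d) wd)
        x⇝l : Walk G (V G - d) x l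
        x⇝l = let z , z∈ , p = blocking d x cut-d x∈ in
          subst (Walk G (V G - d) x) (alone z∈ (l⇝x ++ avoid ¬xc p)) p

    -- Each cut-vertex inside the component of `l` can replace `c` with a strictly smaller
    -- component, so the descent ends at one free of cut-vertices.
    innermost : ∀ {c l} → Alone Z c l → ∃ λ c → Alone Z c l × (∀ {d} → Walk G (V G - c) l d → ¬ Cut G d)
    innermost {c} {l} = go c (<-wellFounded ∣ Component c l ∣)
      where
      go : ∀ c → Acc _<_ ∣ Component c l ∣ → Alone Z c l →
           ∃ λ c → Alone Z c l × (∀ {d} → Walk G (V G - c) l d → ¬ Cut G d)
      go c (acc rec) alone with any? (λ d → walk? G (V G - c) l d ×-dec cut? G d)
      ... | no none = c , alone , λ p cut → none (_ , p , cut)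
      ... | yes (d , p , cut) = let alone′ , smaller = shrink-component alone p cut in
            go d (rec smaller) alone′

    module _ {c l : Fin n} (alone : Alone Z c l) (no-cut : ∀ {d} → Walk G (V G - c) l d → ¬ Cut G d) where

      private
        D : Subset n
        D = Component c l

        D⁻ : ∀ {x} → x ∈ D → Walk G (V G - c) l x
        D⁻ = ∈-⟪⟫⁻ (walk? G (V G - c) l)

        D⁺ : ∀ {x} → Walk G (V G - c) l x → x ∈ D
        D⁺ = ∈-⟪⟫⁺ (walk? G (V G - c) l)

        S : Subset n
        S = D ∪ ⁅ c ⁆

        c∈V : c ∈ V G
        c∈V = proj₁ (proj₁ alone)

        c∈S : c ∈ S
        c∈S = y∈p∪⁅y⁆ D c

        D⊆S : D ⊆ S
        D⊆S = p⊆p∪⁅y⁆ D c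

        D⊆V- : D ⊆ V G - c
        D⊆V- x∈ = last∈ (D⁻ x∈)

        D⊆V : D ⊆ V G
        D⊆V x∈ = p-x⊆p (V G) c (D⊆V- x∈)

        D≢c : ∀ {x} → x ∈ D → x ≢ c
        D≢c x∈ = x∈p-y⇒x≢y (V G) (D⊆V- x∈)

        l∈D : l ∈ D
        l∈D = D⁺ [ proj₁ (proj₂ alone) ]

        S⊆V : S ⊆ V G
        S⊆V x∈ with x∈p∪⁅y⁆⁻ D c x∈
        ... | inj₁ x∈D = D⊆V x∈D
        ... | inj₂ refl = c∈V

        D-closed : ∀ {x y} → x ∈ D → y ≢ c → Adj G x y → y ∈ D
        D-closed x∈ y≢c a = D⁺ (D⁻ x∈ ++ edge (D⊆V- x∈) (x∈p∧x≢y⇒x∈p-y (N⊆V G a) y≢c) a)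

        hub : ∀ {R} → (∀ {x} → x ∈ R → Walk G R x c) → IsConnected G R
        hub to-c u∈ v∈ = to-c u∈ ++ reverse (to-c v∈)

        S-connected : IsConnected G S
        S-connected = hub to-c
          where
          to-c : ∀ {x} → x ∈ S → Walk G S x c
          to-c {x} x∈ with x∈p∪⁅y⁆⁻ D c x∈
          ... | inj₂ refl = [ c∈S ]
          ... | inj₁ x∈D =
                let w , p , wc = until c (D≢c x∈D) (conn (D⊆V x∈D) c∈V) x∈p∧x≢y⇒x∈p-y
                    q = mono D⊆S (stay-in (λ x∈ y∈ → D-closed x∈ (x∈p-y⇒x≢y (V G) y∈)) x∈D p)
                in q ++ edge (last∈ q) c∈S wc

        S-minus : ∀ {z} → z ∈ S → IsConnected G (S - z)
        S-minus {z} z∈ with x∈p∪⁅y⁆⁻ D c z∈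
        ... | inj₂ refl = λ u∈ v∈ → mono (λ x∈ → x∈p∧x≢y⇒x∈p-y (D⊆S x∈) (D≢c x∈))
                (stay-in (λ x∈ y∈ → D-closed x∈ (x∈p-y⇒x≢y (V G) y∈)) (in-D u∈)
                  (reverse (D⁻ (in-D u∈)) ++ D⁻ (in-D v∈)))
          where
          in-D : ∀ {x} → x ∈ S - z → x ∈ D
          in-D {x} x∈ with x∈p∪⁅y⁆⁻ D z (p-x⊆p S z x∈)
          ... | inj₁ x∈D = x∈D
          ... | inj₂ refl = contradiction refl (x∈p-y⇒x≢y S x∈)
        ... | inj₁ z∈D = hub to-c
          where
          c∈S- : c ∈ S - z
          c∈S- = x∈p∧x≢y⇒x∈p-y c∈S (D≢c z∈D ∘ sym)
          D-⊆S- : D - z ⊆ S - z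
          D-⊆S- x∈ = x∈p∧x≢y⇒x∈p-y (D⊆S (p-x⊆p D z x∈)) (x∈p-y⇒x≢y D x∈)
          to-c : ∀ {x} → x ∈ S - z → Walk G (S - z) x c
          to-c {x} x∈ with x∈p∪⁅y⁆⁻ D c (p-x⊆p S z x∈)
          ... | inj₂ refl = [ c∈S- ]
          ... | inj₁ x∈D =
                let w , p , wc = until c (D≢c x∈D)
                      (¬cut⇒connected G (D⊆V z∈D) (no-cut (D⁻ z∈D))
                        (x∈p∧x≢y⇒x∈p-y (D⊆V x∈D) (x∈p-y⇒x≢y S x∈)) (x∈p∧x≢y⇒x∈p-y c∈V (D≢c z∈D ∘ sym)))
                      x∈p∧x≢y⇒x∈p-y
                    q = mono D-⊆S- (stay-in (λ y∈ w∈ a → x∈p∧x≢y⇒x∈p-y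
                            (D-closed (p-x⊆p D z y∈) (x∈p-y⇒x≢y (V G - z) w∈) a)
                            (x∈p-y⇒x≢y (V G) (p-x⊆p (V G - z) c w∈)))
                          (x∈p∧x≢y⇒x∈p-y x∈D (x∈p-y⇒x≢y S x∈)) p)
                in q ++ edge (last∈ q) c∈S- wc

        B : Graph n
        B = induced G S

        V-B⁺ : S ⊆ V B
        V-B⁺ x∈ = x∈p∩q⁺ (S⊆V x∈ , x∈)

        V-B⁻ : V B ⊆ S
        V-B⁻ x∈ = proj₂ (x∈p∩q⁻ (V G) S x∈)

      -- The component `D` together with `c` is 2-connected because no vertex of `D` cuts `G`. It is
      -- maximal because a larger 2-connected subgraph stays connected without `c`, and so lies in
      -- `D` apart from `c`.
      end-block : Block G B
      end-block = record
        { subgraph = record { V-⊆ = λ x∈ → proj₁ (x∈p∩q⁻ (V G) S x∈) ; N-⊆ = λ y∈ → proj₁ (inducedN⁻ G S y∈) }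
        ; twoConnected = induced-twoConnected G S S-connected (λ z∈ ¬conn → ¬conn (S-minus z∈))
        ; maximal = maximal }
        where
        maximal : ∀ {C} → C ⊑ G → TwoConnected C → B ⊑ C → C ≐ B
        maximal {C} C⊑G two B⊑C = record { V-⊆ = V-B⁺ ∘ V⊆S ; N-⊆ = λ {u} y∈ →
            inducedN⁺ G S (N-⊆ C⊑G y∈) (V⊆S (N⊆V C (N-sym C y∈))) (V⊆S (N⊆V C y∈)) } , B⊑C
          where
          V⊆S : V C ⊆ S
          V⊆S {x} x∈ with x ≟ c
          ... | yes refl = c∈S
          ... | no x≢c = decidable-stable (x ∈? S) λ x∉ →
                twoConnected⇒walk C two (V-⊆ B⊑C (V-B⁺ c∈S)) λ conn-C → x∉ (D⊆S (D⁺
                  (mono (λ y∈ → x∈p∧x≢y⇒x∈p-y (V-⊆ C⊑G (p-x⊆p (V C) c y∈)) (x∈p-y⇒x≢y (V C) y∈))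
                    (sub-walk C⊑G (conn-C (x∈p∧x≢y⇒x∈p-y (V-⊆ B⊑C (V-B⁺ (D⊆S l∈D))) (D≢c l∈D))
                                          (x∈p∧x≢y⇒x∈p-y x∈ x≢c))))))

      end-block-leaf : BC.Leaf G (inj₂ (B , end-block))
      end-block-leaf = inj₁ (c , cut⇒CutVertex G (proj₁ alone)) , V-B⁺ c∈S , unique
        where
        unique : ∀ {y} → BC.Edge G (inj₂ (B , end-block)) y →
                 Setoid._≈_ (BC.nodes G) (inj₁ (c , cut⇒CutVertex G (proj₁ alone))) y
        unique {inj₁ (d , cut-d)} d∈ with x∈p∪⁅y⁆⁻ D c (V-B⁻ d∈)
        ... | inj₁ d∈D = contradiction (CutVertex⇒cut G cut-d) (no-cut (D⁻ d∈D))
        ... | inj₂ refl = Pointwise.inj₁ refl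
        unique {inj₂ _} ()

      mark∈end-block : l ∈ V B
      mark∈end-block = V-B⁺ (D⊆S l∈D)

      end-block-mark : ∀ {z} → z ∈ Z → z ∈ V B → z ≡ l
      end-block-mark z∈ z∈B with x∈p∪⁅y⁆⁻ D c (V-B⁻ z∈B)
      ... | inj₁ z∈D = proj₂ (proj₂ alone) z∈ (D⁻ z∈D)
      ... | inj₂ refl = contradiction (proj₁ alone) (simplicial⇒¬cut (proj₂ (sims z∈)))

    -- The last component of the result makes different marks yield different blocks.
    leaf-node : ∀ {l} → l ∈ Z → (∃ λ c → Alone Z c l) →
                Σ (Σ (Graph n) (Block G)) λ B → BC.Leaf G (inj₂ B) × l ∈ V (proj₁ B) ×
                  (∀ {z} → z ∈ Z → z ∈ V (proj₁ B) → z ≡ l)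
    leaf-node l∈ (_ , alone₀) = let _ , alone , no-cut = innermost alone₀ in
      (_ , end-block alone no-cut) , end-block-leaf alone no-cut , mark∈end-block alone no-cut ,
      end-block-mark alone no-cut

-- Every spanning tree has a leaf in each leaf block

unique⇒∣p∣≡1 : ∀ {p : Subset n} {x} → x ∈ p → (∀ {y} → y ∈ p → y ≡ x) → ∣ p ∣ ≡ 1
unique⇒∣p∣≡1 {p = p} {x} x∈ only =
  trans (cong ∣_∣ (⊆-antisym {i = p} {⁅ x ⁆} (λ y∈ → subst (_∈ ⁅ x ⁆) (sym (only y∈)) (x∈⁅x⁆ x))
                             (λ y∈ → subst (_∈ p) (sym (x∈⁅y⁆⇒x≡y x y∈)) x∈)))
        (∣⁅x⁆∣≡1 x)

module _ {G : Graph n} where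

  add-vertex : ∀ {A R a y} → IsConnected G A → a ∈ A → Adj G y a → A ⊆ R → y ∈ R →
               (∀ {x} → x ∈ R → x ∈ A ⊎ x ≡ y) → IsConnected G R
  add-vertex {A} {R} {a} {y} conn a∈ ya A⊆R y∈ split u∈ v∈ = to-a u∈ ++ reverse (to-a v∈)
    where
    to-a : ∀ {x} → x ∈ R → Walk G R x a
    to-a x∈ with split x∈
    ... | inj₁ x∈A = mono A⊆R (conn x∈A a∈)
    ... | inj₂ refl = edge y∈ (A⊆R a∈) ya

  crossing : ∀ {S u v} R → u ∉ R → v ∈ R → Walk G S u v →
             ∃ λ y → ∃ λ y′ → y ∉ R × y′ ∈ R × y ∈ S × y′ ∈ S × Adj G y y′
  crossing R u∉ v∈ [ _ ] = contradiction v∈ u∉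
  crossing R u∉ v∈ (_⟨_⟩_ {v = x} u∈ a p) with x ∈? R
  ... | yes x∈R = _ , x , u∉ , x∈R , u∈ , head∈ p , a
  ... | no x∉R = crossing R x∉R v∈ p

  block-connected : ∀ {B} → B ⊑ G → TwoConnected B → IsConnected G (V B)
  block-connected {B} B⊑G (conn , _) u∈ v∈ = sub-walk B⊑G (connected⇒walk B conn u∈ v∈)

  block-connected- : ∀ {B} → B ⊑ G → TwoConnected B → ∀ {z} → z ∈ V B → ¬ ¬ IsConnected G (V B - z)
  block-connected- {B} B⊑G two z∈ ¬conn = twoConnected⇒walk B two z∈ λ conn →
    ¬conn λ u∈ v∈ → sub-walk B⊑G (conn u∈ v∈)

  ⊑-induced : ∀ {B S} → B ⊑ G → V B ⊆ S → B ⊑ induced G S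
  ⊑-induced {B} {S} B⊑G B⊆S = record
    { V-⊆ = λ x∈ → x∈p∩q⁺ (V-⊆ B⊑G x∈ , B⊆S x∈)
    ; N-⊆ = λ a → inducedN⁺ G S (N-⊆ B⊑G a) (B⊆S (N⊆V B (N-sym B a))) (B⊆S (N⊆V B a)) }

  induced-⊑ : ∀ S → induced G S ⊑ G
  induced-⊑ S = record { V-⊆ = λ x∈ → proj₁ (x∈p∩q⁻ (V G) S x∈) ; N-⊆ = λ a → proj₁ (inducedN⁻ G S a) }

  edge-twoConnected : ∀ {u v} → Adj G u v → TwoConnected (induced G (⁅ u ⁆ ∪ ⁅ v ⁆))
  edge-twoConnected {u} {v} uv = induced-twoConnected G S
      (add-vertex {A = ⁅ u ⁆} (λ x∈ y∈ → trivial (λ z∈ → x∈⁅y⁆⇒x≡y u z∈) x∈ y∈) (x∈⁅x⁆ u) (N-sym G uv)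
        (p⊆p∪⁅y⁆ ⁅ u ⁆ v) (y∈p∪⁅y⁆ ⁅ u ⁆ v) (x∈p∪⁅y⁆⁻ ⁅ u ⁆ v))
      (λ z∈ ¬conn → ¬conn (minus z∈))
    where
    S : Subset n
    S = ⁅ u ⁆ ∪ ⁅ v ⁆
    trivial : ∀ {R w} → (∀ {x} → x ∈ R → x ≡ w) → IsConnected G R
    trivial only x∈ y∈ with trans (only x∈) (sym (only y∈))
    ... | refl = [ x∈ ]
    ends : ∀ {x} → x ∈ S → x ≡ u ⊎ x ≡ v
    ends x∈ with x∈p∪⁅y⁆⁻ ⁅ u ⁆ v x∈
    ... | inj₁ x∈u = inj₁ (x∈⁅y⁆⇒x≡y u x∈u)
    ... | inj₂ x≡v = inj₂ x≡v
    minus : ∀ {z} → z ∈ S → IsConnected G (S - z)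
    minus {z} z∈ with ends z∈
    ... | inj₁ refl = trivial λ x∈ → [ (λ x≡u → contradiction x≡u (x∈p-y⇒x≢y S x∈)) , (λ x≡v → x≡v) ]′ (ends (p-x⊆p S z x∈))
    ... | inj₂ refl = trivial λ x∈ → [ (λ x≡u → x≡u) , (λ x≡v → contradiction x≡v (x∈p-y⇒x≢y S x∈)) ]′ (ends (p-x⊆p S z x∈))

  block-induced : ∀ {B S} → Block G B → V B ⊆ S → TwoConnected (induced G S) → induced G S ⊑ B
  block-induced blk B⊆S two = proj₁ (Block.maximal blk (induced-⊑ _) two (⊑-induced (Block.subgraph blk) B⊆S))

  twoConnected-induced : ∀ {B} → B ⊑ G → TwoConnected B → TwoConnected (induced G (V B))
  twoConnected-induced {B} B⊑G two =
    induced-twoConnected G (V B) (block-connected B⊑G two) (block-connected- B⊑G two)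

  -- By maximality a block has all edges of `G` between its vertices, so vertex sets decide
  -- containment.
  block-⊆ : ∀ {B B′} → Block G B → Block G B′ → V B ⊆ V B′ → B ⊑ B′
  block-⊆ {B} {B′} blk blk′ B⊆B′ = ⊑-trans (⊑-induced (Block.subgraph blk) B⊆B′)
    (block-induced blk′ (λ x∈ → x∈) (twoConnected-induced (Block.subgraph blk′) (Block.twoConnected blk′)))

  -- A subgraph of largest order among the 2-connected ones containing C induces a block.
  ¬¬block : ∀ C → C ⊑ G → TwoConnected C → ¬ (∀ {B} → Block G B → ¬ C ⊑ B)
  ¬¬block C = go C (<-wellFounded ∣ ∁ (V C) ∣)
    where
    go : ∀ C → Acc _<_ ∣ ∁ (V C) ∣ → C ⊑ G → TwoConnected C → ¬ (∀ {B} → Block G B → ¬ C ⊑ B)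
    go C (acc rec) C⊑G two none = none blk C⊑C′
      where
      C′ : Graph n
      C′ = induced G (V C)
      C⊑C′ : C ⊑ C′
      C⊑C′ = ⊑-induced C⊑G (λ x∈ → x∈)
      maximal : ∀ {D} → D ⊑ G → TwoConnected D → C′ ⊑ D → D ≐ C′
      maximal {D} D⊑G two-D C′⊑D with any? (λ x → (x ∈? V D) ×-dec ¬? (x ∈? V C))
      ... | no none = ⊑-induced D⊑G (λ {x} x∈ → decidable-stable (x ∈? V C) λ x∉ → none (x , x∈ , x∉)) , C′⊑D
      ... | yes (x , x∈ , x∉) = ⊥-elim (go D
              (rec (p⊂q⇒∣p∣<∣q∣ ((λ y∈ → x∉p⇒x∈∁p λ y∈C → x∈∁p⇒x∉p y∈ (V-⊆ C⊑D y∈C)) ,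
                    x , x∉p⇒x∈∁p x∉ , λ x∈∁ → x∈∁p⇒x∉p x∈∁ x∈)))
              D⊑G two-D (λ blk D⊑B → none blk (⊑-trans C⊑D D⊑B)))
        where
        C⊑D : C ⊑ D
        C⊑D = ⊑-trans C⊑C′ C′⊑D
      blk : Block G C′
      blk = record { subgraph = induced-⊑ (V C) ; twoConnected = twoConnected-induced C⊑G two ; maximal = maximal }

module _ (G : Graph n) (connected : Connected G) (chordal : Chordal G) where

  private
    conn : IsConnected G (V G)
    conn = connected⇒walk G connected

  -- Every edge at `c` lies in a block. If `B` were the only block at `c`, all neighbours of `c`
  -- would lie in `B`, which stays connected without `c`, and then so would `G`.
  cut-not-leaf : ∀ {c} → ¬ BC.Leaf G (inj₁ c)
  cut-not-leaf (inj₁ _ , () , _)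
  cut-not-leaf {c , cut} (inj₂ (B , blk) , c∈ , unique) with CutVertex⇒cut G cut
  ... | _ , u , v , u∈ , v∈ , ¬p =
    block-connected- (Block.subgraph blk) (Block.twoConnected blk) c∈ λ conn-B →
      let w , p , wc = to-c u∈
          w′ , p′ , w′c = to-c v∈
      in ¬p (p ++ (mono B-⊆ (conn-B (in-B- wc) (in-B- w′c)) ++ reverse p′))
    where
    to-c : ∀ {x} → x ∈ V G - c → ∃ λ w → Walk G (V G - c) x w × Adj G w c
    to-c x∈ = until c (x∈p-y⇒x≢y (V G) x∈) (conn (p-x⊆p (V G) c x∈) (proj₁ cut)) x∈p∧x≢y⇒x∈p-y
    B-⊆ : V B - c ⊆ V G - c
    B-⊆ x∈ = x∈p∧x≢y⇒x∈p-y (V-⊆ (Block.subgraph blk) (p-x⊆p (V B) c x∈)) (x∈p-y⇒x≢y (V B) x∈)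
    same : ∀ {B′} (blk′ : Block G B′) → c ∈ V B′ → B′ ⊑ B
    same blk′ c∈′ with unique {inj₂ (_ , blk′)} c∈′
    ... | Pointwise.inj₂ (_ , B′⊑B) = B′⊑B
    in-B- : ∀ {w} → Adj G w c → w ∈ V B - c
    in-B- {w} wc = x∈p∧x≢y⇒x∈p-y (decidable-stable (w ∈? V B) λ w∉ →
        ¬¬block _ (induced-⊑ (⁅ c ⁆ ∪ ⁅ w ⁆)) (edge-twoConnected {G = G} (N-sym G wc)) λ blk′ e⊑ →
          w∉ (V-⊆ (same blk′ (V-⊆ e⊑ (x∈p∩q⁺ (proj₁ cut , p⊆p∪⁅y⁆ ⁅ c ⁆ w (x∈⁅x⁆ c)))))
                  (V-⊆ e⊑ (x∈p∩q⁺ (N⊆V G (N-sym G wc) , y∈p∪⁅y⁆ ⁅ c ⁆ w)))))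
      (adj⇒≢ G wc)

  record LeafBlock (B : Graph n) : Set where
    field
      block   : Block G B
      cut     : Fin n
      cut∈    : cut ∈ V B
      is-cut  : Cut G cut
      only    : ∀ {d} → d ∈ V B → Cut G d → d ≡ cut

  leafBlock : ∀ {B blk} → BC.Leaf G (inj₂ (B , blk)) → LeafBlock B
  leafBlock (inj₂ _ , () , _)
  leafBlock {B} {blk} (inj₁ (c , cut-c) , c∈ , unique) = record
    { block = blk ; cut = c ; cut∈ = c∈ ; is-cut = CutVertex⇒cut G cut-c ; only = only }
    where
    only : ∀ {d} → d ∈ V B → Cut G d → d ≡ c
    only {d} d∈ cut-d with unique {inj₁ (d , cut⇒CutVertex G cut-d)} d∈
    ... | Pointwise.inj₁ c≡d = sym c≡d

  module _ {B : Graph n} (leaf-block : LeafBlock B) where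

    open LeafBlock leaf-block renaming (cut to c; cut∈ to c∈; block to blk)
    open Block blk renaming (subgraph to B⊑G; twoConnected to two)

    ¬cut : ∀ {w} → w ∈ V B - c → ¬ Cut G w
    ¬cut w∈ cut-w = x∈p-y⇒x≢y (V B) w∈ (only (p-x⊆p (V B) c w∈) cut-w)

    -- Otherwise B extends by a vertex y outside B adjacent to both w and another vertex y′ of B.
    block-closed : ∀ {w u} → w ∈ V B - c → Adj G w u → u ∈ V B
    block-closed {w} {u} w∈ wu = decidable-stable (u ∈? V B) absurd
      where
      w∈B : w ∈ V B
      w∈B = p-x⊆p (V B) c w∈
      w∈V : w ∈ V G
      w∈V = V-⊆ B⊑G w∈B
      absurd : u ∉ V B → ⊥
      absurd u∉ =
        let b , wb , p = firstStep≢ (x∈p-y⇒x≢y (V B) w∈) (connected⇒walk B (proj₁ two) w∈B c∈)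
            wb = N-⊆ B⊑G wb
            near-w : ∀ {x} → Adj G w x → x ∈ V G - w
            near-w wx = x∈p∧x≢y⇒x∈p-y (N⊆V G wx) (adj⇒≢ G wx ∘ sym)
            -- Since `w` is not a cut-vertex, `u` and `b` are joined in `G - w`, by chordality even
            -- inside the neighbourhood of `w`; this walk enters `B` along `yy′`.
            q = neighbourhood-walk {G = G} chordal {Y = V G - w} (λ w∈- → x∈p-y⇒x≢y (V G) w∈- refl) wu wb
                  (¬cut⇒connected G w∈V (¬cut w∈) (near-w wu) (near-w wb))
        in extend (crossing (V B) u∉ (p-x⊆p (V B) w (head∈ p)) q)
        where
        extend : (∃ λ y → ∃ λ y′ → y ∉ V B × y′ ∈ V B × y ∈ (V G - w) ∩ N G w ×
                   y′ ∈ (V G - w) ∩ N G w × Adj G y y′) → ⊥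
        extend (y , y′ , y∉ , y′∈ , y∈N , y′∈N , yy′) =
          y∉ (V-⊆ (block-induced blk (p⊆p∪⁅y⁆ (V B) y) (induced-twoConnected G S S-connected S-minus))
                  (x∈p∩q⁺ (N⊆V G wy , y∈p∪⁅y⁆ (V B) y)))
          where
          S : Subset n
          S = V B ∪ ⁅ y ⁆
          wy : Adj G w y
          wy = proj₂ (x∈p∩q⁻ (V G - w) (N G w) y∈N)
          wy′ : Adj G w y′
          wy′ = proj₂ (x∈p∩q⁻ (V G - w) (N G w) y′∈N)
          S-connected : IsConnected G S
          S-connected = add-vertex (block-connected B⊑G two) w∈B (N-sym G wy) (p⊆p∪⁅y⁆ (V B) y)
                          (y∈p∪⁅y⁆ (V B) y) (x∈p∪⁅y⁆⁻ (V B) y)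
          S-minus : ∀ {z} → z ∈ S → ¬ ¬ IsConnected G (S - z)
          S-minus {z} z∈ ¬conn with x∈p∪⁅y⁆⁻ (V B) y z∈
          ... | inj₂ refl = ¬conn λ u∈ v∈ →
                mono (λ x∈ → x∈p∧x≢y⇒x∈p-y (p⊆p∪⁅y⁆ (V B) y x∈) (λ { refl → y∉ x∈ }))
                  (block-connected B⊑G two (in-B u∈) (in-B v∈))
            where
            in-B : ∀ {x} → x ∈ S - y → x ∈ V B
            in-B x∈ = [ (λ x∈B → x∈B) , (λ x≡y → contradiction x≡y (x∈p-y⇒x≢y S x∈)) ]′
                        (x∈p∪⁅y⁆⁻ (V B) y (p-x⊆p S y x∈))
          ... | inj₁ z∈B = block-connected- B⊑G two z∈B λ conn-B → ¬conn (join conn-B (w ≟ z))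
            where
            grow : IsConnected G (V B - z) → ∀ {a} → a ∈ V B → a ≢ z → Adj G y a → IsConnected G (S - z)
            grow conn-B a∈ a≢z ya = add-vertex conn-B (x∈p∧x≢y⇒x∈p-y a∈ a≢z) ya
              (λ x∈ → x∈p∧x≢y⇒x∈p-y (p⊆p∪⁅y⁆ (V B) y (p-x⊆p (V B) z x∈)) (x∈p-y⇒x≢y (V B) x∈))
              (x∈p∧x≢y⇒x∈p-y (y∈p∪⁅y⁆ (V B) y) (λ { refl → y∉ z∈B }))
              (λ x∈ → [ (λ x∈B → inj₁ (x∈p∧x≢y⇒x∈p-y x∈B (x∈p-y⇒x≢y S x∈))) , inj₂ ]′
                        (x∈p∪⁅y⁆⁻ (V B) y (p-x⊆p S z x∈)))
            -- Of the two neighbours `w` and `y′` of `y` in `B`, at least one survives the deletion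
            -- of `z`.
            join : IsConnected G (V B - z) → Dec (w ≡ z) → IsConnected G (S - z)
            join conn-B (no w≢z) = grow conn-B w∈B w≢z (N-sym G wy)
            join conn-B (yes refl) = grow conn-B y′∈ (adj⇒≢ G wy′ ∘ sym) yy′

    block-inner : ∃ λ x → x ∈ V B - c
    block-inner with any? (λ x → x ∈? (V B - c))
    ... | yes found = found
    ... | no none =
          let _ , u , _ , u∈ , _ = is-cut
              v , cv , _ = firstStep≢ (x∈p-y⇒x≢y (V G) u∈ ∘ sym) (conn (V-⊆ B⊑G c∈) (p-x⊆p (V G) c u∈))
              v∈ = V-⊆ (block-induced {S = ⁅ c ⁆ ∪ ⁅ v ⁆} blk
                         (λ x∈ → p⊆p∪⁅y⁆ ⁅ c ⁆ v (subst (_∈ ⁅ c ⁆) (sym (is-c x∈)) (x∈⁅x⁆ c)))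
                         (edge-twoConnected {G = G} cv))
                       (x∈p∩q⁺ (N⊆V G cv , y∈p∪⁅y⁆ ⁅ c ⁆ v))
          in contradiction (sym (is-c v∈)) (adj⇒≢ G cv)
      where
      is-c : ∀ {x} → x ∈ V B → x ≡ c
      is-c {x} x∈ = decidable-stable (x ≟ c) λ x≢c → none (x , x∈p∧x≢y⇒x∈p-y x∈ x≢c)

    inner-closed : ∀ {x y} → x ∈ V B - c → y ≢ c → Adj G x y → y ∈ V B - c
    inner-closed x∈ y≢c a = x∈p∧x≢y⇒x∈p-y (block-closed x∈ a) y≢c

    -- The tree has an edge at `c` inside `B`, so a path in the tree from `c` within `B` ends at
    -- some `l ≢ c`. All neighbours of `l` lie in `B`, so having one neighbour there makes it a leaf
    -- of the whole tree.
    block-leaf : ∀ {T} → SpanningTree G T → ∃ λ l → l ∈ leaves T × l ∈ V B - c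
    block-leaf {T} T-spanning =
      let x₀ , x₀∈ = block-inner
          w , p , wc = until c (x∈p-y⇒x≢y (V B) x₀∈) (to-c x₀∈) x∈p∧x≢y⇒x∈p-y
          w∈ = last∈ (stay-in (λ x∈ y∈ a → inner-closed x∈ (x∈p-y⇒x≢y (V T) y∈) (N-⊆ subgraph a)) x₀∈ p)
          l , l∈ , l≢c , end = path-end {H = T} (proj₂ tree) {V B} {c} c∈ (p-x⊆p (V B) c w∈) (N-sym T wc)
          l∈- = x∈p∧x≢y⇒x∈p-y l∈ l≢c
          y , ly , _ = firstStep≢ l≢c (to-c l∈-)
          closed = λ {z} (lz : Adj T l z) → block-closed l∈- (N-⊆ subgraph lz)
      in l , ∈-leaves⁺ T (unique⇒∣p∣≡1 ly λ lz → end (closed lz) (closed ly) lz ly) , l∈-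
      where
      open SpanningTree T-spanning
      to-c : ∀ {x} → x ∈ V B - c → Walk T (V T) x c
      to-c x∈ = connected⇒walk T (proj₁ tree)
        (subst (_ ∈_) (sym spanning) (V-⊆ B⊑G (p-x⊆p (V B) c x∈))) (subst (c ∈_) (sym spanning) (V-⊆ B⊑G c∈))

  -- Walks inside the first block from `l` avoid `c′` until they reach the first cut-vertex, as no
  -- other vertex of that block cuts; hence they cannot leave the second block.
  leafBlock-⊆ : ∀ {B B′} (L : LeafBlock B) (L′ : LeafBlock B′) → ∀ {l} → l ∈ V B - LeafBlock.cut L →
                l ∈ V B′ - LeafBlock.cut L′ → V B ⊆ V B′
  leafBlock-⊆ {B} {B′} L L′ {l} l∈ l∈′ {x} x∈ with x ≟ LeafBlock.cut L
  ... | no x≢c = p-x⊆p (V B′) c′ (inner (x∈p∧x≢y⇒x∈p-y x∈ x≢c))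
    where
    open LeafBlock L
    open LeafBlock L′ using () renaming (cut to c′; is-cut to is-cut′)
    inner : V B - cut ⊆ V B′ - c′
    inner {y} y∈ = decidable-stable (y ∈? (V B′ - c′)) λ y∉ →
      block-connected- (Block.subgraph block) (Block.twoConnected block) cut∈ λ conn-B → y∉ (last∈
        (stay-in (λ u∈ v∈ a → inner-closed L′ u∈ (λ { refl → ¬cut L v∈ is-cut′ }) a) l∈′ (conn-B l∈ y∈)))
  ... | yes refl =
        let w , p , wc = until x (x∈p-y⇒x≢y (V B) l∈)
              (block-connected (Block.subgraph block) (Block.twoConnected block) (p-x⊆p (V B) x l∈) x∈) x∈p∧x≢y⇒x∈p-y
        in block-closed L′ (last∈
             (stay-in (λ u∈ v∈ a → inner-closed L′ u∈ (λ { refl → ¬cut L v∈ is-cut′ }) a) l∈′ p)) wc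
    where
    open LeafBlock L
    open LeafBlock L′ using () renaming (cut to c′; is-cut to is-cut′)

  leafBlock-≐ : ∀ {B B′} (L : LeafBlock B) (L′ : LeafBlock B′) → ∀ {l} → l ∈ V B - LeafBlock.cut L →
                l ∈ V B′ - LeafBlock.cut L′ → B ≐ B′
  leafBlock-≐ L L′ l∈ l∈′ = block-⊆ (LeafBlock.block L) (LeafBlock.block L′) (leafBlock-⊆ L L′ l∈ l∈′) ,
                            block-⊆ (LeafBlock.block L′) (LeafBlock.block L) (leafBlock-⊆ L′ L l∈′ l∈)

-- Counting

element : (p : Subset n) → Fin ∣ p ∣ → Fin n
element (inside ∷ p) zero = zero
element (inside ∷ p) (suc i) = suc (element p i)
element (outside ∷ p) i = suc (element p i)

element∈ : (p : Subset n) → ∀ i → element p i ∈ p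
element∈ (inside ∷ p) zero = here
element∈ (inside ∷ p) (suc i) = there (element∈ p i)
element∈ (outside ∷ p) i = there (element∈ p i)

element-injective : (p : Subset n) → Injective _≡_ _≡_ (element p)
element-injective (inside ∷ p) {zero} {zero} _ = refl
element-injective (inside ∷ p) {suc i} {suc j} eq = cong suc (element-injective p (Fin-suc-injective eq))
element-injective (outside ∷ p) eq = element-injective p (Fin-suc-injective eq)

position : (p : Subset n) → ∀ {x} → x ∈ p → ∃ λ i → element p i ≡ x
position (inside ∷ p) here = zero , refl
position (inside ∷ p) (there x∈) = let i , eq = position p x∈ in suc i , cong suc eq
position (outside ∷ p) (there x∈) = let i , eq = position p x∈ in i , cong suc eq

injective⇒surjective : ∀ {k} (f : Fin k → Fin k) → Injective _≡_ _≡_ f → ∀ y → ∃ λ x → f x ≡ y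
injective⇒surjective {k} f f-injective y = decidable-stable (any? λ x → f x ≟ y) λ missed →
  let g : Fin (suc k) → Fin k
      g = λ { zero → y ; (suc x) → f x }
  in n≮n k (injective⇒≤ {f = g} λ
       { {zero} {zero} _ → refl
       ; {zero} {suc x} eq → contradiction (x , sym eq) missed
       ; {suc x} {zero} eq → contradiction (x , eq) missed
       ; {suc x} {suc x′} eq → cong suc (f-injective eq) })

module _ (S : Setoid 0ℓ 0ℓ) where

  open Setoid S using (Carrier; _≈_)

  -- A map into `Fin k` may depend on the representative of a class, as the leaf chosen in a block
  -- may; it only has to reflect `≈`.
  InjectsInto InjectedBy : ℕ → Set
  InjectsInto k = Σ (Carrier → Fin k) λ g → ∀ {x y} → g x ≡ g y → x ≈ y
  InjectedBy k = Σ (Fin k → Carrier) λ f → ∀ {i j} → f i ≈ f j → i ≡ j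

  count-≤ : ∀ {k m} → InjectedBy k → InjectsInto m → k ≤ m
  count-≤ (f , f-inj) (g , g-inj) = injective⇒≤ {f = g ∘ f} (f-inj ∘ g-inj)

  -- By the pigeonhole principle `g ∘ f` is onto. As `g` reflects equality, `f` is onto up to `≈`,
  -- and choosing preimages respects `≈` because `f` is injective.
  hasExactly : ∀ {k} → InjectedBy k → InjectsInto k → HasExactly k S
  hasExactly {k} (f , f-inj) (g , g-inj) = record
    { to = f
    ; from = proj₁ ∘ preimage
    ; to-cong = λ { refl → Setoid.refl S }
    ; from-cong = λ x≈y → f-inj (Setoid.trans S (proj₂ (preimage _)) (Setoid.trans S x≈y (Setoid.sym S (proj₂ (preimage _)))))
    ; inverse = (λ { refl → proj₂ (preimage _) })
              , (λ x≈ → f-inj (Setoid.trans S (proj₂ (preimage _)) x≈))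
    }
    where
    preimage : ∀ x → ∃ λ i → f i ≈ x
    preimage x = let i , eq = injective⇒surjective (g ∘ f) (f-inj ∘ g-inj) (g x) in i , g-inj eq

  hasExactly⇒injectedBy : ∀ {k} → HasExactly k S → InjectedBy k
  hasExactly⇒injectedBy inv = Inverse.to inv , λ fi≈fj →
    trans (sym (Inverse.strictlyInverseʳ inv _)) (trans (Inverse.from-cong inv fi≈fj) (Inverse.strictlyInverseʳ inv _))

  hasExactly⇒injectsInto : ∀ {k} → HasExactly k S → InjectsInto k
  hasExactly⇒injectsInto inv = Inverse.from inv , λ {x} {y} eq → Setoid.trans S
    (Setoid.sym S (Inverse.strictlyInverseˡ inv x))
    (Setoid.trans S (Inverse.to-cong inv eq) (Inverse.strictlyInverseˡ inv y))

module _ (G : Graph n) (connected : Connected G) (chordal : Chordal G) where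

  private
    Node : Set
    Node = Setoid.Carrier (BC.leaves G)

  leaf-nodes-inject : ∀ {T} → SpanningTree G T → InjectsInto (BC.leaves G) ∣ leaves T ∣
  leaf-nodes-inject {T} T-spanning = (λ x → proj₁ (index x)) , λ {x} {y} eq → ψ-injective {x} {y}
      (trans (sym (proj₂ (index x))) (trans (cong (element (leaves T)) eq) (proj₂ (index y))))
    where
    ψ : (x : Node) → ∃ λ l → l ∈ leaves T
    ψ (inj₁ c , leaf) = ⊥-elim (cut-not-leaf G connected chordal leaf)
    ψ (inj₂ B , leaf) = let l , l∈ , _ = block-leaf G connected chordal (leafBlock G connected chordal leaf) T-spanning in l , l∈
    ψ-injective : ∀ {x y} → proj₁ (ψ x) ≡ proj₁ (ψ y) → Setoid._≈_ (BC.leaves G) x y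
    ψ-injective {inj₁ c , leaf} {_} _ = ⊥-elim (cut-not-leaf G connected chordal leaf)
    ψ-injective {inj₂ B , _} {inj₁ c , leaf} _ = ⊥-elim (cut-not-leaf G connected chordal leaf)
    ψ-injective {inj₂ B , leaf} {inj₂ B′ , leaf′} eq =
      let L = leafBlock G connected chordal leaf
          L′ = leafBlock G connected chordal leaf′
          _ , _ , l∈ = block-leaf G connected chordal L T-spanning
          _ , _ , l∈′ = block-leaf G connected chordal L′ T-spanning
      in Pointwise.inj₂ (leafBlock-≐ G connected chordal L L′ (subst (_∈ V (proj₁ B) - LeafBlock.cut L) eq l∈) l∈′)
    index : ∀ x → ∃ λ i → element (leaves T) i ≡ proj₁ (ψ x)
    index x = position (leaves T) (proj₂ (ψ x))

  MarkedNode : Subset n → Fin n → Set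
  MarkedNode Z l = Σ (Σ (Graph n) (Block G)) λ B → BC.Leaf G (inj₂ B) × l ∈ V (proj₁ B) ×
                     (∀ {z} → z ∈ Z → z ∈ V (proj₁ B) → z ≡ l)

  marked-nodes-inject : ∀ {Z} (p : Subset n) → p ⊆ Z → (∀ {l} → l ∈ Z → MarkedNode Z l) →
                        InjectedBy (BC.leaves G) ∣ p ∣
  marked-nodes-inject {Z} p p⊆Z node = f , f-injective
    where
    at : ∀ i → MarkedNode Z (element p i)
    at i = node (p⊆Z (element∈ p i))
    f : Fin ∣ p ∣ → Node
    f i = inj₂ (proj₁ (at i)) , proj₁ (proj₂ (at i))
    f-injective : ∀ {i j} → Setoid._≈_ (BC.leaves G) (f i) (f j) → i ≡ j
    f-injective {i} {j} (Pointwise.inj₂ (_ , B′⊑B)) =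
      let _ , _ , l∈B , _ = at j
          _ , _ , _ , only = at i
      in element-injective p (sym (only (p⊆Z (element∈ p j)) (V-⊆ B′⊑B l∈B)))

  leaf-nodes-injected : ClawFree G → (∃ λ v → CutVertex G v) →
                        ∃ λ T → SpanningTree G T × InjectedBy (BC.leaves G) ∣ leaves T ∣
  leaf-nodes-injected claw-free (v , cut-v) = build (minimal-blocking G connected chordal)
    where
    build : (∃ λ Z → Simplicials G connected chordal Z × CutBlocking G connected chordal Z ×
              (∀ {l} → l ∈ Z → ∃ λ c → Alone G connected chordal Z c l)) →
            ∃ λ T → SpanningTree G T × InjectedBy (BC.leaves G) ∣ leaves T ∣
    build (Z , sims , cut-blocking , alone) =
      let nonempty , blocking = cutBlocking⇒blocking G connected chordal sims cut-blocking (v , CutVertex⇒cut G cut-v)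
          T , T-spanning , leaves⊆Z = spanning-graph G
            (spanning-tree G chordal claw-free (connected⇒walk G connected) sims nonempty blocking)
      in T , T-spanning , marked-nodes-inject (leaves T) leaves⊆Z
           (λ l∈ → leaf-node G connected chordal sims cut-blocking l∈ (alone l∈))

corollary3 : ∀ {n} (G : Graph n) → Connected G → NCPathTreeGraph G → (∃ λ v → CutVertex G v) →
    ∀ (ℓ : ℕ) →
    (∃ λ T → MinimumLeafSpanningTree G T × ∣ leaves T ∣ ≡ ℓ) ⇔ HasExactly ℓ (BC.leaves G)
corollary3 G connected (_ , P , T , model , non-crossing) cut ℓ =
  optimal (leaf-nodes-injected G connected chordal (model-claw-free model non-crossing) cut)
  where
  chordal : Chordal G
  chordal = model-chordal model
  S = BC.leaves G
  into : ∀ {T} → SpanningTree G T → InjectsInto S ∣ leaves T ∣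
  into = leaf-nodes-inject G connected chordal
  optimal : (∃ λ T₀ → SpanningTree G T₀ × InjectedBy S ∣ leaves T₀ ∣) →
            (∃ λ T → MinimumLeafSpanningTree G T × ∣ leaves T ∣ ≡ ℓ) ⇔ HasExactly ℓ S
  -- The leaves of `T₀` inject into the leaf nodes, and these into the leaves of every spanning
  -- tree, so `T₀` is a minimum and its leaves are as many as the leaf nodes.
  optimal (T₀ , spanning₀ , by₀) = mk⇔
    (λ { (T , (T-spanning , minimal) , refl) →
         subst (λ k → HasExactly k S) (≤-antisym (count-≤ S by₀ (into T-spanning)) (minimal T₀ spanning₀))
           (hasExactly S by₀ (into spanning₀)) })
    (λ exact → T₀ ,
      (spanning₀ , λ T′ spanning′ → count-≤ S by₀ (into spanning′)) ,
      ≤-antisym (count-≤ S by₀ (hasExactly⇒injectsInto S exact))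
                (count-≤ S (hasExactly⇒injectedBy S exact) (into spanning₀)))
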